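{- Every nonzero $\mathbf a\in\mathcal P^1_1$ has the strong anticupping property.
   Context: For $A,B\subseteq\mathbb N^{\mathbb N}$, $A\le^1_1B$ (Medvedev reducibility) means that there is a partial computable function $\Gamma:\subseteq\mathbb N^{\mathbb N}\to\mathbb N^{\mathbb N}$ defined on all of $B$ with $\Gamma(g)\in A$ for every $g\in B$. The $(1,1)$-degree of $A\subseteq\mathbb N^{\mathbb N}$ is its class under the equivalence $\equiv^1_1$ induced by $\le^1_1$; degrees are ordered by $\le^1_1$ on representatives. $\mathcal P^1_1$ is the set of $(1,1)$-degrees of nonempty $\Pi^0_1$ subsets of $2^{\mathbb N}$. The zero degree is the least degree (the degree of the sets containing a computable element), and the join $\mathbf b\vee\mathbf c$ of the degrees of $B$ and $C$ is the degree of $B\otimes C=\{f\oplus g:f\in B,\ g\in C\}$, where $(f\oplus g)(2n)=f(n)$ and $(f\oplus g)(2n+1)=g(n)$. A degree $\mathbf a\in\mathcal P^1_1$ has the strong anticupping property if there is a nonzero degree $\mathbf b\in\mathcal P^1_1$ such that, for any $(1,1)$-degree $\mathbf c$ (of an arbitrary subset of $\mathbb N^{\mathbb N}$), if $\mathbf a\le\mathbf b\vee\mathbf c$, then $\mathbf a\le\mathbf c$. -}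

module Defs where

open import Data.Bool using (if_then_else_)
open import Data.Fin using (Fin)
open import Data.Nat using (ℕ; zero; suc; _<_; _≡ᵇ_)
open import Data.Nat.DivMod using (_/_; _%_)
open import Data.Product using (∃-syntax; _×_; _,_)
open import Data.Sum using (_⊎_)
open import Data.Unit using (tt)
open import Data.Vec using (Vec; []; _∷_; lookup)
open import Data.Vec.Relation.Binary.Pointwise.Inductive using (Pointwise)
open import Function.Bundles using (_⇔_)
open import Level using (0ℓ) renaming (suc to lsuc)
open import Relation.Binary.Definitions using (Minimum)
open import Relation.Binary.PropositionalEquality using (_≗_)
open import Relation.Nullary using (¬_)
open import Relation.Unary using (Pred; _∈_; U; Satisfiable)

Baire : Set
Baire = ℕ → ℕ

-- Arbitrary subsets of ℕ^ℕ.  Predicates are not required to respect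
-- pointwise equality: membership is only ever used through pointwise
-- descriptions, so a predicate stands for its closure under _≗_.
Subset : Set₁
Subset = Pred Baire 0ℓ

Cantor : Subset
Cantor f = ∀ n → f n < 2

-- μ-recursive functions relative to an oracle in ℕ^ℕ, by arity.
data Code : ℕ → Set where
  zero   : Code 0
  suc    : Code 1
  oracle : Code 1
  proj   : ∀ {k} → Fin k → Code k
  comp   : ∀ {k m} → Code m → Vec (Code k) m → Code k
  prec   : ∀ {k} → Code k → Code (suc (suc k)) → Code (suc k)
  mu     : ∀ {k} → Code (suc k) → Code k

-- g ⊢ e · xs ⇓ y : with oracle g, the code e halts on input xs with value y.
infix 4 _⊢_·_⇓_

data _⊢_·_⇓_ (g : Baire) : ∀ {k} → Code k → Vec ℕ k → ℕ → Set where
  zero      : g ⊢ zero · [] ⇓ 0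
  suc       : ∀ {x} → g ⊢ suc · (x ∷ []) ⇓ suc x
  oracle    : ∀ {x} → g ⊢ oracle · (x ∷ []) ⇓ g x
  proj      : ∀ {k} {xs : Vec ℕ k} (i : Fin k) → g ⊢ proj i · xs ⇓ lookup xs i
  comp      : ∀ {k m} {e : Code m} {es : Vec (Code k) m} {xs ys z} →
              Pointwise (λ d y → g ⊢ d · xs ⇓ y) es ys →
              g ⊢ e · ys ⇓ z →
              g ⊢ comp e es · xs ⇓ z
  prec-zero : ∀ {k} {b : Code k} {s xs y} →
              g ⊢ b · xs ⇓ y →
              g ⊢ prec b s · (0 ∷ xs) ⇓ y
  prec-suc  : ∀ {k} {b : Code k} {s n xs y z} →
              g ⊢ prec b s · (n ∷ xs) ⇓ y →
              g ⊢ s · (n ∷ y ∷ xs) ⇓ z →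
              g ⊢ prec b s · (suc n ∷ xs) ⇓ z
  mu        : ∀ {k} {e : Code (suc k)} {xs y} →
              g ⊢ e · (y ∷ xs) ⇓ 0 →
              (∀ {i} → i < y → ∃[ v ] g ⊢ e · (i ∷ xs) ⇓ suc v) →
              g ⊢ mu e · xs ⇓ y

-- A unary code Γ denotes the partial computable functional whose domain is
-- the set of g for which Γ halts with oracle g on every input.
-- Γ ⟨ g ⟩= f says that g is in the domain and is sent to f.
_⟨_⟩=_ : Code 1 → Baire → Baire → Set
Γ ⟨ g ⟩= f = ∀ n → g ⊢ Γ · (n ∷ []) ⇓ f n

infix 4 _≤¹₁_ _≡¹₁_

_≤¹₁_ : Subset → Subset → Set
A ≤¹₁ B = ∃[ Γ ] (∀ g → g ∈ B → ∃[ f ] (f ∈ A × Γ ⟨ g ⟩= f))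

-- (1,1)-degrees are represented by subsets, with _≡¹₁_ as equality.
_≡¹₁_ : Subset → Subset → Set
A ≡¹₁ B = A ≤¹₁ B × B ≤¹₁ A

𝟎 : Subset
𝟎 = U

𝟎-minimum : Minimum _≤¹₁_ 𝟎
𝟎-minimum A = oracle , λ g _ → g , tt , λ n → oracle

Nonzero : Pred Subset 0ℓ
Nonzero A = ¬ (A ≡¹₁ 𝟎)

infixr 6 _⊕_ _⊗_

_⊕_ : Baire → Baire → Baire
(f ⊕ g) n = if n % 2 ≡ᵇ 0 then f (n / 2) else g (n / 2)

-- The join of the degrees of B and C is the degree of B ⊗ C.
_⊗_ : Subset → Subset → Subset
(B ⊗ C) h = ∃[ f ] ∃[ g ] (f ∈ B × g ∈ C × h ≗ f ⊕ g)

-- P = { f ∈ 2^ℕ : ∀ n, R(n, f) } for a computable relation R on ℕ × 2^ℕ,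
-- given by a code for its {0,1}-valued characteristic function.
Π⁰₁ : Pred Subset 0ℓ
Π⁰₁ P = ∃[ R ]
  ( (∀ f → f ∈ Cantor → ∀ n → f ⊢ R · (n ∷ []) ⇓ 0 ⊎ f ⊢ R · (n ∷ []) ⇓ 1)
  × (∀ f → f ∈ P ⇔ (f ∈ Cantor × (∀ n → f ⊢ R · (n ∷ []) ⇓ 1))) )

-- The degree of A contains a nonempty Π⁰₁ subset of 2^ℕ.
𝒫¹₁ : Pred Subset (lsuc 0ℓ)
𝒫¹₁ A = ∃[ P ] (Satisfiable P × Π⁰₁ P × A ≡¹₁ P)

StrongAnticupping : Pred Subset (lsuc 0ℓ)
StrongAnticupping A =
  ∃[ B ] (B ∈ 𝒫¹₁ × Nonzero B × (∀ C → A ≤¹₁ B ⊗ C → A ≤¹₁ C))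

-- Let P be the given Π⁰₁ class and T a computable tree with set of paths P.
-- Take for B the sequences of marked and unmarked bits such that the marked
-- bits (the header) and each maximal run of unmarked bits (a block) lie on T.
-- A member of B has a path of T as its header if it has infinitely many marks
-- and as its last block otherwise, so B is nonzero when P is.
--
-- Suppose Γ maps B ⊗ C into P and let c ∈ C.  From c alone one builds a
-- sequence whose header is Γ's own output: given a finite string β whose
-- header is the first k bits output by Γ on β ⊕ c, search for an extension
-- that makes Γ output one more bit and that remains on T in the above sense
-- once this bit is appended as a mark.  The search succeeds because β followed
-- by a path of T is in B, and the headers converge to a path of T.

module Submission where

open import Axiom.ExcludedMiddle using (ExcludedMiddle)
open import Data.Fin using (Fin; zero; suc; _↑ˡ_; _↑ʳ_)
open import Data.Nat
open import Data.Nat.DivMod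
open import Data.Nat.Properties
open import Data.Product using (∃-syntax; _×_; _,_; proj₁; proj₂)
open import Data.Sum using (_⊎_; inj₁; inj₂)
open import Data.Vec using (Vec; []; _∷_; lookup; tabulate; head; tail; _++_; map)
open import Data.Vec.Properties using (lookup-++ˡ; lookup-++ʳ)
open import Data.Vec.Relation.Binary.Pointwise.Inductive using (Pointwise; []; _∷_; ++⁺)
open import Function using (_∘_)
open import Function.Bundles using (_⇔_; mk⇔; Equivalence)
open import Level using (0ℓ)
open import Relation.Binary.Definitions using (tri<; tri≈; tri>)
open import Relation.Binary.PropositionalEquality
open import Relation.Nullary using (yes; no; contradiction)
open import Relation.Unary using (_∈_; Satisfiable)
open import Defs

-- Determinism of computations and change of oracle.

mutual
  deterministic : ∀ {g k} {e : Code k} {xs y z} → g ⊢ e · xs ⇓ y → g ⊢ e · xs ⇓ z → y ≡ z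
  deterministic zero zero = refl
  deterministic suc suc = refl
  deterministic oracle oracle = refl
  deterministic (proj i) (proj .i) = refl
  deterministic (comp ds d) (comp ds′ d′) with refl ← deterministic* ds ds′ = deterministic d d′
  deterministic (prec-zero d) (prec-zero d′) = deterministic d d′
  deterministic (prec-suc d₁ d₂) (prec-suc d₁′ d₂′) with refl ← deterministic d₁ d₁′ =
    deterministic d₂ d₂′
  deterministic (mu {y = y} d f) (mu {y = z} d′ f′) with <-cmp y z
  -- Of two distinct results the smaller has value 0 by one derivation and a successor value by the
  -- other.
  ... | tri< y<z _ _ = contradiction (deterministic d (proj₂ (f′ y<z))) λ ()
  ... | tri≈ _ y≡z _ = y≡z
  ... | tri> _ _ z<y = contradiction (deterministic (proj₂ (f z<y)) d′) λ ()

  deterministic* : ∀ {g k m} {es : Vec (Code k) m} {xs ys zs} →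
                   Pointwise (λ e y → g ⊢ e · xs ⇓ y) es ys →
                   Pointwise (λ e y → g ⊢ e · xs ⇓ y) es zs → ys ≡ zs
  deterministic* [] [] = refl
  deterministic* (d ∷ ds) (d′ ∷ ds′) = cong₂ _∷_ (deterministic d d′) (deterministic* ds ds′)

projections : ∀ {k m} → (Fin m → Fin k) → Vec (Code k) m
projections π = tabulate (proj ∘ π)

projections⇓ : ∀ {g k m} (π : Fin m → Fin k) {xs} (ys : Vec ℕ m) →
               (∀ i → lookup xs (π i) ≡ lookup ys i) →
               Pointwise (λ e y → g ⊢ e · xs ⇓ y) (projections π) ys
projections⇓ π [] eq = []
projections⇓ π (y ∷ ys) eq =
  subst (_ ⊢ _ · _ ⇓_) (eq zero) (proj (π zero)) ∷ projections⇓ (π ∘ suc) ys (eq ∘ suc)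

-- Replaces the oracle by the functions computed by d, whose remaining
-- arguments are appended to those of the code.
mutual
  relativise : ∀ {k n} → Code (suc n) → Code k → Code (k + n)
  relativise d zero = comp zero []
  relativise d suc = comp suc (proj zero ∷ [])
  relativise d oracle = d
  relativise d (proj i) = proj (i ↑ˡ _)
  -- The outer code makes oracle calls too, so the parameters of `d` are handed on to it by trailing
  -- projections.
  relativise d (comp {m = m} e es) =
    comp (relativise d e) (relativise* d es ++ projections (_ ↑ʳ_))
  relativise d (prec b s) = prec (relativise d b) (relativise d s)
  relativise d (mu e) = mu (relativise d e)

  relativise* : ∀ {k m n} → Code (suc n) → Vec (Code k) m → Vec (Code (k + n)) m
  relativise* d [] = []
  relativise* d (e ∷ es) = relativise d e ∷ relativise* d es

module _ {g h : Baire} {n : ℕ} {d : Code (suc n)} {ρ : Vec ℕ n}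
         (d⇓ : ∀ x → g ⊢ d · x ∷ ρ ⇓ h x) where

  mutual
    relativise⇓ : ∀ {k} {e : Code k} {xs y} → h ⊢ e · xs ⇓ y → g ⊢ relativise d e · xs ++ ρ ⇓ y
    relativise⇓ zero = comp [] zero
    relativise⇓ suc = comp (proj zero ∷ []) suc
    relativise⇓ (oracle {x}) = d⇓ x
    relativise⇓ (proj {xs = xs} i) =
      subst (_ ⊢ _ · _ ⇓_) (lookup-++ˡ xs ρ i) (proj (i ↑ˡ _))
    relativise⇓ (comp {xs = xs} ds e) =
      comp (++⁺ (relativise*⇓ ds) (projections⇓ _ ρ (lookup-++ʳ xs ρ))) (relativise⇓ e)
    relativise⇓ (prec-zero b) = prec-zero (relativise⇓ b)
    relativise⇓ (prec-suc r s) = prec-suc (relativise⇓ r) (relativise⇓ s)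
    relativise⇓ (mu e f) = mu (relativise⇓ e) λ i<y → proj₁ (f i<y) , relativise⇓ (proj₂ (f i<y))

    relativise*⇓ : ∀ {k m} {es : Vec (Code k) m} {xs ys} →
                   Pointwise (λ e y → h ⊢ e · xs ⇓ y) es ys →
                   Pointwise (λ e y → g ⊢ e · xs ++ ρ ⇓ y) (relativise* d es) ys
    relativise*⇓ [] = []
    relativise*⇓ (e ∷ es) = relativise⇓ e ∷ relativise*⇓ es

-- Medvedev reducibility is a preorder.

≤¹₁-refl : ∀ {A} → A ≤¹₁ A
≤¹₁-refl = oracle , λ g g∈A → g , g∈A , λ n → oracle

-- Functionals compose by substituting `Δ` for the oracle of `Γ`, here without parameters.
≤¹₁-trans : ∀ {A B C} → A ≤¹₁ B → B ≤¹₁ C → A ≤¹₁ C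
≤¹₁-trans (Γ , Γ-total) (Δ , Δ-total) = relativise Δ Γ , λ g g∈C →
  let f , f∈B , Δg=f = Δ-total g g∈C
      e , e∈A , Γf=e = Γ-total f f∈B
  in e , e∈A , λ n → relativise⇓ Δg=f (Γf=e n)

-- Total computable functionals and their closure properties.

-- Only functionals total on every oracle are covered; unbounded search enters separately, through
-- `mu⇓`.
record Computable {k} (F : Baire → Vec ℕ k → ℕ) : Set where
  constructor _computes_
  field
    code : Code k
    spec : ∀ g xs → g ⊢ code · xs ⇓ F g xs

record Computable* {k m} (F : Baire → Vec ℕ k → Vec ℕ m) : Set where
  constructor _computes_
  field
    codes : Vec (Code k) m
    specs : ∀ g xs → Pointwise (λ e y → g ⊢ e · xs ⇓ y) codes (F g xs)

open Computable
open Computable*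

private
  variable
    k m : ℕ
    F G H : Baire → Vec ℕ k → ℕ

computable-≗ : (∀ g xs → F g xs ≡ G g xs) →
          Computable F → Computable G
computable-≗ F≗G (e computes ⇓) = e computes λ g xs → subst (g ⊢ e · xs ⇓_) (F≗G g xs) (⇓ g xs)

var : ∀ (i : Fin k) → Computable (λ _ xs → lookup xs i)
var i = proj i computes λ _ _ → proj i

infixr 5 _∷ᶜ_
infixr 4 _∘ᶜ_ _∘ᶜ*_

[]ᶜ : ∀ {k} → Computable* {k} (λ _ _ → [])
[]ᶜ = [] computes λ _ _ → []

_∷ᶜ_ : ∀ {k m} {F : Baire → Vec ℕ k → ℕ} {G : Baire → Vec ℕ k → Vec ℕ m} →
       Computable F → Computable* G → Computable* (λ g xs → F g xs ∷ G g xs)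
(e computes ⇓) ∷ᶜ (es computes ⇓⇓) = (e ∷ es) computes λ g xs → ⇓ g xs ∷ ⇓⇓ g xs

tailᶜ : ∀ {k} → Computable* {suc k} (λ _ → tail)
tailᶜ = projections suc computes λ { g (x ∷ xs) → projections⇓ suc xs λ i → refl }

headᶜ : ∀ {k} → Computable {suc k} (λ _ → head)
headᶜ = proj zero computes λ { g (x ∷ xs) → proj zero }

_∘ᶜ_ : ∀ {k m} {F : Baire → Vec ℕ m → ℕ} {G : Baire → Vec ℕ k → Vec ℕ m} →
       Computable F → Computable* G → Computable (λ g xs → F g (G g xs))
(e computes ⇓) ∘ᶜ (es computes ⇓⇓) = comp e es computes λ g xs → comp (⇓⇓ g xs) (⇓ g _)

_∘ᶜ*_ : ∀ {k m n} {F : Baire → Vec ℕ m → Vec ℕ n} {G : Baire → Vec ℕ k → Vec ℕ m} →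
        Computable* F → Computable* G → Computable* (λ g xs → F g (G g xs))
(es computes es⇓) ∘ᶜ* (ds computes ds⇓) = go es computes λ g xs → go⇓ (ds⇓ g xs) (es⇓ g _)
  where
  go : ∀ {n} → Vec (Code _) n → Vec (Code _) n
  go [] = []
  go (e ∷ es) = comp e ds ∷ go es

  go⇓ : ∀ {g xs ys n} {es : Vec (Code _) n} {zs : Vec ℕ n} → Pointwise (λ e y → g ⊢ e · xs ⇓ y) ds ys →
        Pointwise (λ e z → g ⊢ e · ys ⇓ z) es zs → Pointwise (λ e z → g ⊢ e · xs ⇓ z) (go es) zs
  go⇓ ds [] = []
  go⇓ ds (e ∷ es) = comp ds e ∷ go⇓ ds es

-- Lets a computation use an oracle that is itself computed from `g` and the arguments. Headers,
-- blocks and coded strings are all supplied as oracles in this way.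
with-oracle : ∀ {k m} {D : Baire → Vec ℕ (suc k) → ℕ} {F : Baire → Vec ℕ m → ℕ}
              {G : Baire → Vec ℕ k → Vec ℕ m} →
              Computable D → Computable F → Computable* G →
              Computable (λ g xs → F (λ x → D g (x ∷ xs)) (G g xs))
with-oracle (d computes d⇓) (e computes e⇓) (es computes es⇓) =
  comp (relativise d e) (es ++ projections λ i → i) computes λ g xs →
    comp (++⁺ (es⇓ g xs) (projections⇓ _ xs λ _ → refl)) (relativise⇓ (λ x → d⇓ g (x ∷ xs)) (e⇓ _ _))

zeroᶜ : ∀ {k} → Computable {k} (λ _ _ → 0)
zeroᶜ = comp zero [] computes λ _ _ → comp [] zero

sucᶜ : Computable F → Computable (λ g xs → suc (F g xs))
sucᶜ (e computes ⇓) = comp suc (e ∷ []) computes λ g xs → comp (⇓ g xs ∷ []) suc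

litᶜ : ∀ {k} n → Computable {k} (λ _ _ → n)
litᶜ zero = zeroᶜ
litᶜ (suc n) = sucᶜ (litᶜ n)

oracleᶜ : Computable F → Computable (λ g xs → g (F g xs))
oracleᶜ (e computes ⇓) = comp oracle (e ∷ []) computes λ g xs → comp (⇓ g xs ∷ []) oracle

-- Has exactly the recursion pattern of `prec`; other arithmetic functions are first rewritten with
-- it and then transferred along pointwise equality.
natrec : ℕ → (ℕ → ℕ → ℕ) → ℕ → ℕ
natrec z s zero = z
natrec z s (suc n) = s n (natrec z s n)

natrecᶜ : ∀ {k} {Z N : Baire → Vec ℕ k → ℕ} {S : Baire → Vec ℕ (suc (suc k)) → ℕ} →
          Computable Z → Computable S → Computable N →
          Computable (λ g xs → natrec (Z g xs) (λ i r → S g (i ∷ r ∷ xs)) (N g xs))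
natrecᶜ {Z = Z} {N} {S} (z computes z⇓) (s computes s⇓) (n computes n⇓) =
  comp (prec z s) (n ∷ projections λ i → i) computes λ g xs →
    comp (n⇓ g xs ∷ projections⇓ _ xs λ _ → refl) (prec⇓ g xs (N g xs))
  where
  prec⇓ : ∀ g xs n → g ⊢ prec z s · n ∷ xs ⇓ natrec (Z g xs) (λ i r → S g (i ∷ r ∷ xs)) n
  prec⇓ g xs zero = prec-zero (z⇓ g xs)
  prec⇓ g xs (suc n) = prec-suc (prec⇓ g xs n) (s⇓ g _)

-- The given zero `n` only guarantees termination and may differ from the least zero `y`. The search
-- climbs from 0 with `r` as its remaining distance to `n`.
mu⇓ : ∀ {k} {F : Baire → Vec ℕ (suc k) → ℕ} (c : Computable F) g xs {n} → F g (n ∷ xs) ≡ 0 →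
      ∃[ y ] F g (y ∷ xs) ≡ 0 × g ⊢ mu (code c) · xs ⇓ y
mu⇓ {F = F} c g xs {n} Fn≡0 = search n 0 (+-identityʳ n) λ ()
  where
  found : ∀ y → F g (y ∷ xs) ≡ 0 → (∀ {i} → i < y → F g (i ∷ xs) ≢ 0) →
          g ⊢ mu (code c) · xs ⇓ y
  found y Fy≡0 least = mu (subst (g ⊢ code c · y ∷ xs ⇓_) Fy≡0 (spec c g _)) λ {i} i<y →
    pred (F g (i ∷ xs)) ,
    subst (g ⊢ code c · i ∷ xs ⇓_) (sym (suc-pred _ {{≢-nonZero (least i<y)}})) (spec c g _)

  search : ∀ r y → r + y ≡ n → (∀ {i} → i < y → F g (i ∷ xs) ≢ 0) →
           ∃[ y ] F g (y ∷ xs) ≡ 0 × g ⊢ mu (code c) · xs ⇓ y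
  search r y eq least with F g (y ∷ xs) ≟ 0
  ... | yes Fy≡0 = y , Fy≡0 , found y Fy≡0 least
  search zero y refl least | no Fy≢0 = contradiction Fn≡0 Fy≢0
  search (suc r) y eq least | no Fy≢0 = search r (suc y) (trans (+-suc r y) eq) λ i<1+y Fi≡0 →
    case-< (m<1+n⇒m<n∨m≡n i<1+y) Fi≡0
    where
    case-< : ∀ {i} → i < y ⊎ i ≡ y → F g (i ∷ xs) ≢ 0
    case-< (inj₁ i<y) = least i<y
    case-< (inj₂ refl) = Fy≢0

-- Arithmetic

ifz : ℕ → ℕ → ℕ → ℕ
ifz n a b = natrec a (λ _ _ → b) n

infixl 6 _+ᶜ_ _∸ᶜ_

predᶜ : Computable F → Computable (λ g xs → pred (F g xs))
predᶜ {F = F} f = computable-≗ (λ g xs → eq (F g xs)) (natrecᶜ zeroᶜ (var zero) f)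
  where
  eq : ∀ n → natrec 0 (λ i _ → i) n ≡ pred n
  eq zero = refl
  eq (suc n) = refl

_+ᶜ_ : Computable F → Computable G → Computable (λ g xs → F g xs + G g xs)
_+ᶜ_ {F = F} {G = G} f g = computable-≗ (λ g xs → eq (F g xs) (G g xs)) (natrecᶜ g (sucᶜ (var (suc zero))) f)
  where
  eq : ∀ m n → natrec n (λ _ r → suc r) m ≡ m + n
  eq zero n = refl
  eq (suc m) n = cong suc (eq m n)

ifzᶜ : Computable F → Computable G → Computable H →
       Computable (λ g xs → ifz (F g xs) (G g xs) (H g xs))
ifzᶜ {H = H} f g h = natrecᶜ {S = λ g xs → H g (tail (tail xs))} g (h ∘ᶜ (tailᶜ ∘ᶜ* tailᶜ)) f

_∸ᶜ_ : Computable F → Computable G → Computable (λ g xs → F g xs ∸ G g xs)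
_∸ᶜ_ {F = F} {G = G} f g = computable-≗ (λ g xs → eq (F g xs) (G g xs)) (natrecᶜ f (predᶜ (var (suc zero))) g)
  where
  eq : ∀ m n → natrec m (λ _ r → pred r) n ≡ m ∸ n
  eq m zero = refl
  eq m (suc n) = trans (cong pred (eq m n)) (pred[m∸n]≡m∸[1+n] m n)

distᶜ : Computable F → Computable G → Computable (λ g xs → ∣ F g xs - G g xs ∣)
distᶜ {F = F} {G = G} f g = computable-≗ (λ g xs → eq (F g xs) (G g xs)) ((f ∸ᶜ g) +ᶜ (g ∸ᶜ f))
  where
  eq : ∀ m n → (m ∸ n) + (n ∸ m) ≡ ∣ m - n ∣
  eq zero zero = refl
  eq zero (suc n) = refl
  eq (suc m) zero = +-identityʳ (suc m)
  eq (suc m) (suc n) = eq m n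

%2ᶜ : Computable F → Computable (λ g xs → F g xs % 2)
%2ᶜ {F = F} f = computable-≗ (λ g xs → eq (F g xs)) (natrecᶜ zeroᶜ (litᶜ 1 ∸ᶜ var (suc zero)) f)
  where
  flip : ∀ n → 1 ∸ n % 2 ≡ suc n % 2
  flip zero = refl
  flip (suc zero) = refl
  flip (suc (suc n)) = flip n

  eq : ∀ n → natrec 0 (λ _ r → 1 ∸ r) n ≡ n % 2
  eq zero = refl
  eq (suc n) = trans (cong (1 ∸_) (eq n)) (flip n)

2+n/2 : ∀ n → suc (suc n) / 2 ≡ suc (n / 2)
2+n/2 n = m/n≡1+[m∸n]/n {suc (suc n)} {2} (s≤s (s≤s z≤n))

/2ᶜ : Computable F → Computable (λ g xs → F g xs / 2)
/2ᶜ {F = F} f = computable-≗ (λ g xs → eq (F g xs))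
  (natrecᶜ zeroᶜ (var (suc zero) +ᶜ %2ᶜ (var zero)) f)
  where
  step : ∀ n → n / 2 + n % 2 ≡ suc n / 2
  step zero = refl
  step (suc zero) = refl
  step (suc (suc n)) = begin
    suc (suc n) / 2 + n % 2  ≡⟨ cong (_+ n % 2) (2+n/2 n) ⟩
    suc (n / 2 + n % 2)      ≡⟨ cong suc (step n) ⟩
    suc (suc n / 2)          ≡⟨ 2+n/2 (suc n) ⟨
    suc (suc (suc n)) / 2    ∎
    where open ≡-Reasoning

  eq : ∀ n → natrec 0 (λ i r → r + i % 2) n ≡ n / 2
  eq zero = refl
  eq (suc n) = trans (cong (_+ n % 2) (eq n)) (step n)

-- Conditions are coded as numbers that vanish when the condition holds, so a finite sum acts as a
-- bounded universal quantifier.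
∑< : ℕ → (ℕ → ℕ) → ℕ
∑< n f = natrec 0 (λ i r → r + f i) n

∑<≡0⇒≡0 : ∀ n {f} → ∑< n f ≡ 0 → ∀ {i} → i < n → f i ≡ 0
∑<≡0⇒≡0 (suc n) {f} eq i<1+n with m<1+n⇒m<n∨m≡n i<1+n
... | inj₁ i<n = ∑<≡0⇒≡0 n (m+n≡0⇒m≡0 _ eq) i<n
... | inj₂ refl = m+n≡0⇒n≡0 (∑< n f) eq

≡0⇒∑<≡0 : ∀ n {f} → (∀ {i} → i < n → f i ≡ 0) → ∑< n f ≡ 0
≡0⇒∑<≡0 zero eq = refl
≡0⇒∑<≡0 (suc n) eq = cong₂ _+_ (≡0⇒∑<≡0 n λ i<n → eq (m<n⇒m<1+n i<n)) (eq ≤-refl)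

∑<-cong : ∀ n {f f′} → (∀ {i} → i < n → f i ≡ f′ i) → ∑< n f ≡ ∑< n f′
∑<-cong zero eq = refl
∑<-cong (suc n) eq = cong₂ _+_ (∑<-cong n λ i<n → eq (m<n⇒m<1+n i<n)) (eq ≤-refl)

∑<ᶜ : ∀ {k} {N : Baire → Vec ℕ k → ℕ} {F : Baire → Vec ℕ (suc k) → ℕ} →
      Computable N → Computable F → Computable (λ g xs → ∑< (N g xs) λ i → F g (i ∷ xs))
∑<ᶜ {F = F} n f = natrecᶜ {S = λ g xs → head (tail xs) + F g (head xs ∷ tail (tail xs))}
  zeroᶜ ((headᶜ ∘ᶜ tailᶜ) +ᶜ (f ∘ᶜ headᶜ ∷ᶜ (tailᶜ ∘ᶜ* tailᶜ))) n

-- Bounded evaluation.  Partial values are encoded as numbers: 0 is undefined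
-- and suc y is the value y.

mu-step : ℕ → ℕ → ℕ
mu-step i v = ifz v 1 (ifz (pred v) (suc (suc i)) 0)

-- 0: still searching, 1: met an undefined value, suc (suc y): found y.
mu-search : (ℕ → ℕ) → ℕ → ℕ
mu-search u = natrec 0 λ i a → ifz a (mu-step i (u i)) a

all-defined : Vec ℕ m → ℕ
all-defined [] = 1
all-defined (v ∷ vs) = ifz v 0 (all-defined vs)

mutual
  -- The oracle `φ` is partial too, in the same encoding. The bound `s` limits only the searches of
  -- `mu`.
  eval : Baire → ℕ → Code k → Vec ℕ k → ℕ
  eval φ s zero xs = 1
  eval φ s suc xs = suc (suc (head xs))
  eval φ s oracle xs = φ (head xs)
  eval φ s (proj i) xs = suc (lookup xs i)
  -- Without the guard `pred` would turn an undefined argument into the value 0.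
  eval φ s (comp e es) xs =
    ifz (all-defined (eval* φ s es xs)) 0 (eval φ s e (map pred (eval* φ s es xs)))
  eval φ s (prec b e) xs =
    natrec (eval φ s b (tail xs)) (λ i r → ifz r 0 (eval φ s e (i ∷ pred r ∷ tail xs))) (head xs)
  eval φ s (mu e) xs = pred (mu-search (λ i → eval φ s e (i ∷ xs)) s)

  eval* : Baire → ℕ → Vec (Code k) m → Vec ℕ k → Vec ℕ m
  eval* φ s [] xs = []
  eval* φ s (e ∷ es) xs = eval φ s e xs ∷ eval* φ s es xs

mu-search-zero : ∀ u s → mu-search u s ≡ 0 → ∀ {i} → i < s → ∃[ v ] u i ≡ suc (suc v)
mu-search-zero u (suc s) eq i<1+s
  with mu-search u s in eq′
... | zero with u s in us≡
...   | suc (suc v) with m<1+n⇒m<n∨m≡n i<1+s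
...     | inj₁ i<s = mu-search-zero u s eq′ i<s
...     | inj₂ refl = v , us≡

mu-search-found : ∀ u s {y} → mu-search u s ≡ suc (suc y) →
                  u y ≡ 1 × (∀ {i} → i < y → ∃[ v ] u i ≡ suc (suc v))
mu-search-found u (suc s) eq with mu-search u s in eq′
mu-search-found u (suc s) refl | suc (suc y) = mu-search-found u s eq′
mu-search-found u (suc s) eq | zero with u s in us≡
mu-search-found u (suc s) refl | zero | suc zero = us≡ , mu-search-zero u s eq′

mu-search-below : ∀ u s → (∀ {i} → i < s → ∃[ v ] u i ≡ suc (suc v)) → mu-search u s ≡ 0
mu-search-below u zero below = refl
mu-search-below u (suc s) below
  rewrite mu-search-below u s (λ i<s → below (m<n⇒m<1+n i<s)) | proj₂ (below {s} ≤-refl) = refl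

mu-search-complete : ∀ u {y} s → u y ≡ 1 → (∀ {i} → i < y → ∃[ v ] u i ≡ suc (suc v)) →
                     y < s → mu-search u s ≡ suc (suc y)
mu-search-complete u {y} (suc s) uy≡1 below y<1+s with m<1+n⇒m<n∨m≡n y<1+s
... | inj₁ y<s rewrite mu-search-complete u s uy≡1 below y<s = refl
... | inj₂ refl rewrite mu-search-below u s below | uy≡1 = refl

pred-suc : ∀ n {y} → pred n ≡ suc y → n ≡ suc (suc y)
pred-suc (suc n) = cong suc

all-defined⇒ : ∀ (vs : Vec ℕ m) {z} → ∀ a → ifz (all-defined vs) 0 a ≡ suc z →
               Pointwise (λ v y → v ≡ suc y) vs (map pred vs) × a ≡ suc z
all-defined⇒ [] a eq = [] , eq
all-defined⇒ (suc v ∷ vs) a eq with all-defined⇒ vs a eq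
... | vs≡ , a≡ = refl ∷ vs≡ , a≡

⇒all-defined : ∀ {vs ys : Vec ℕ m} → Pointwise (λ v y → v ≡ suc y) vs ys →
               all-defined vs ≡ 1 × map pred vs ≡ ys
⇒all-defined [] = refl , refl
⇒all-defined (refl ∷ eqs) with ⇒all-defined eqs
... | eq , refl = eq , refl

ifz-guard : ∀ n {a y} → ifz n 0 a ≡ suc y → ∃[ m ] n ≡ suc m × a ≡ suc y
ifz-guard (suc n) eq = n , refl , eq

module _ {φ h : Baire} {s : ℕ} (φ⊑h : ∀ {x y} → φ x ≡ suc y → h x ≡ y) where

  mutual
    -- An evaluation with a defined result has only used places where `φ` is defined, and there `φ`
    -- tells the truth about `h`.
    eval-sound : ∀ (e : Code k) xs {y} → eval φ s e xs ≡ suc y → h ⊢ e · xs ⇓ y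
    eval-sound zero [] refl = zero
    eval-sound suc (x ∷ []) refl = suc
    eval-sound oracle (x ∷ []) eq = subst (h ⊢ oracle · x ∷ [] ⇓_) (φ⊑h eq) oracle
    eval-sound (proj i) xs refl = proj i
    eval-sound (comp e es) xs eq with all-defined⇒ (eval* φ s es xs) _ eq
    ... | vs≡ , e≡ = comp (eval-sound* es xs vs≡) (eval-sound e _ e≡)
    eval-sound (prec b e) (n ∷ xs) eq = go n eq
      where
      go : ∀ n {y} → eval φ s (prec b e) (n ∷ xs) ≡ suc y → h ⊢ prec b e · n ∷ xs ⇓ y
      go zero eq = prec-zero (eval-sound b xs eq)
      go (suc n) eq with r , n≡ , e≡ ← ifz-guard (eval φ s (prec b e) (n ∷ xs)) eq =
        prec-suc (go n n≡) (subst (λ r → h ⊢ e · n ∷ r ∷ xs ⇓ _) (cong pred n≡) (eval-sound e _ e≡))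
    eval-sound (mu e) xs eq with mu-search-found (λ i → eval φ s e (i ∷ xs)) s (pred-suc _ eq)
    ... | e≡ , below = mu (eval-sound e _ e≡) λ i<y →
      proj₁ (below i<y) , eval-sound e _ (proj₂ (below i<y))

    eval-sound* : ∀ (es : Vec (Code k) m) xs {ys} → Pointwise (λ v y → v ≡ suc y) (eval* φ s es xs) ys →
                  Pointwise (λ e y → h ⊢ e · xs ⇓ y) es ys
    eval-sound* [] xs [] = []
    eval-sound* (e ∷ es) xs (eq ∷ eqs) = eval-sound e xs eq ∷ eval-sound* es xs eqs

-- The use principle: halting computations need only finitely much of the oracle.

Agree : ℕ → Baire → Baire → Set
Agree n f g = ∀ {x} → x < n → f x ≡ g x

agree-≤ : ∀ {m n f g} → m ≤ n → Agree n f g → Agree m f g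
agree-≤ m≤n f≈g x<m = f≈g (<-≤-trans x<m m≤n)

agree-trans : ∀ {n f g h} → Agree n f g → Agree n g h → Agree n f h
agree-trans f≈g g≈h x<n = trans (f≈g x<n) (g≈h x<n)

-- Finitely many bounds merge into their maximum because `P` is monotone in the bound.
bounded-sup : ∀ n {P : ℕ → ℕ → Set} → (∀ {i a b} → a ≤ b → P i a → P i b) →
              (∀ {i} → i < n → ∃[ a ] P i a) → ∃[ a ] (∀ {i} → i < n → P i a)
bounded-sup zero mono f = 0 , λ ()
bounded-sup (suc n) {P} mono f with bounded-sup n {P} mono (λ i<n → f (m<n⇒m<1+n i<n)) | f {n} ≤-refl
... | a , Pa | b , Pb = a ⊔ b , λ i<1+n → case (m<1+n⇒m<n∨m≡n i<1+n)
  where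
  case : ∀ {i} → i < n ⊎ i ≡ n → P i (a ⊔ b)
  case (inj₁ i<n) = mono (m≤m⊔n a b) (Pa i<n)
  case (inj₂ refl) = mono (m≤n⊔m a b) Pb

-- One number `N` bounds both the search length and the use; values of `φ` from `N` on are
-- arbitrary.
EvaluatesFrom : Baire → Code k → Vec ℕ k → ℕ → ℕ → Set
EvaluatesFrom h e xs y N =
  ∀ {s φ} → N ≤ s → Agree N φ (λ x → suc (h x)) → eval φ s e xs ≡ suc y

module _ {h : Baire} where

  evaluates-≤ : ∀ {e : Code k} {xs y a b} → a ≤ b → EvaluatesFrom h e xs y a → EvaluatesFrom h e xs y b
  evaluates-≤ a≤b ev b≤s φ≈h = ev (≤-trans a≤b b≤s) (agree-≤ a≤b φ≈h)

  mutual
    -- Induction on the derivation, taking the maximum of the bounds of the finitely many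
    -- subcomputations.
    eval-complete : ∀ {e : Code k} {xs y} → h ⊢ e · xs ⇓ y → ∃[ N ] EvaluatesFrom h e xs y N
    eval-complete zero = 0 , λ _ _ → refl
    eval-complete suc = 0 , λ _ _ → refl
    eval-complete (oracle {x}) = suc x , λ _ φ≈h → φ≈h ≤-refl
    eval-complete (proj i) = 0 , λ _ _ → refl
    eval-complete (comp {e = e} ds d) with eval-complete* ds | eval-complete d
    ... | N , evs | M , ev = N ⊔ M , λ {s} N⊔M≤s φ≈h →
      let defined , vs≡ys = ⇒all-defined (evs (m⊔n≤o⇒m≤o N M N⊔M≤s) (agree-≤ (m≤m⊔n N M) φ≈h)) in
      trans (cong₂ (λ d vs → ifz d 0 (eval _ s e vs)) defined vs≡ys)
            (ev (m⊔n≤o⇒n≤o N M N⊔M≤s) (agree-≤ (m≤n⊔m N M) φ≈h))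
    eval-complete (prec-zero d) = eval-complete d
    eval-complete (prec-suc {s = e} {n = n} {xs = xs} d₁ d₂) with eval-complete d₁ | eval-complete d₂
    ... | N , ev₁ | M , ev₂ = N ⊔ M , λ {s} N⊔M≤s φ≈h →
      trans (cong (λ r → ifz r 0 (eval _ s e (n ∷ pred r ∷ xs)))
              (ev₁ (m⊔n≤o⇒m≤o N M N⊔M≤s) (agree-≤ (m≤m⊔n N M) φ≈h)))
            (ev₂ (m⊔n≤o⇒n≤o N M N⊔M≤s) (agree-≤ (m≤n⊔m N M) φ≈h))
    eval-complete (mu {e = e} {xs = xs} {y = y} d f)
      with eval-complete d
         | bounded-sup y {λ i a → ∃[ v ] EvaluatesFrom h e (i ∷ xs) (suc v) a}
             (λ a≤b (v , ev) → v , evaluates-≤ {e = e} a≤b ev)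
             (λ i<y → let N , ev = eval-complete (proj₂ (f i<y)) in N , proj₁ (f i<y) , ev)
    -- The search examines only numbers below its bound, so the bound has to exceed `y`.
    ... | N , ev | M , evs = suc y ⊔ (N ⊔ M) , λ {s} {φ} le φ≈h →
      let N≤ = ≤-trans (m≤m⊔n N M) (m≤n⊔m (suc y) (N ⊔ M))
          M≤ = ≤-trans (m≤n⊔m N M) (m≤n⊔m (suc y) (N ⊔ M))
      in cong pred (mu-search-complete (λ i → eval φ s e (i ∷ xs)) s (ev (≤-trans N≤ le) (agree-≤ N≤ φ≈h))
           (λ i<y → proj₁ (evs i<y) , proj₂ (evs i<y) (≤-trans M≤ le) (agree-≤ M≤ φ≈h))
           (m⊔n≤o⇒m≤o (suc y) (N ⊔ M) le))

    eval-complete* : ∀ {es : Vec (Code k) m} {xs ys} → Pointwise (λ e y → h ⊢ e · xs ⇓ y) es ys →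
                     ∃[ N ] (∀ {s φ} → N ≤ s → Agree N φ (λ x → suc (h x)) →
                             Pointwise (λ v y → v ≡ suc y) (eval* φ s es xs) ys)
    eval-complete* [] = 0 , λ _ _ → []
    eval-complete* (d ∷ ds) with eval-complete d | eval-complete* ds
    ... | N , ev | M , evs = N ⊔ M , λ N⊔M≤s φ≈h →
      ev (m⊔n≤o⇒m≤o N M N⊔M≤s) (agree-≤ (m≤m⊔n N M) φ≈h) ∷
      evs (m⊔n≤o⇒n≤o N M N⊔M≤s) (agree-≤ (m≤n⊔m N M) φ≈h)

-- Extensionality and computability of bounded evaluation.

natrec-cong : ∀ {z z′ s s′} n → z ≡ z′ → (∀ i r → s i r ≡ s′ i r) → natrec z s n ≡ natrec z′ s′ n
natrec-cong zero z≡ s≡ = z≡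
natrec-cong {s′ = s′} (suc n) z≡ s≡ = trans (s≡ n _) (cong (s′ n) (natrec-cong n z≡ s≡))

mutual
  eval-cong : ∀ {φ ψ} → φ ≗ ψ → ∀ s (e : Code k) xs → eval φ s e xs ≡ eval ψ s e xs
  eval-cong φ≗ψ s zero xs = refl
  eval-cong φ≗ψ s suc xs = refl
  eval-cong φ≗ψ s oracle xs = φ≗ψ (head xs)
  eval-cong φ≗ψ s (proj i) xs = refl
  eval-cong φ≗ψ s (comp e es) xs rewrite eval*-cong φ≗ψ s es xs =
    cong (ifz (all-defined (eval* _ s es xs)) 0) (eval-cong φ≗ψ s e _)
  eval-cong φ≗ψ s (prec b e) xs = natrec-cong (head xs) (eval-cong φ≗ψ s b _)
    λ i r → cong (ifz r 0) (eval-cong φ≗ψ s e (i ∷ pred r ∷ tail xs))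
  eval-cong φ≗ψ s (mu e) xs = cong pred (natrec-cong s refl
    λ i a → cong (λ v → ifz a (mu-step i v) a) (eval-cong φ≗ψ s e (i ∷ xs)))

  eval*-cong : ∀ {φ ψ} → φ ≗ ψ → ∀ s (es : Vec (Code k) m) xs → eval* φ s es xs ≡ eval* ψ s es xs
  eval*-cong φ≗ψ s [] xs = refl
  eval*-cong φ≗ψ s (e ∷ es) xs = cong₂ _∷_ (eval-cong φ≗ψ s e xs) (eval*-cong φ≗ψ s es xs)

all-definedᶜ : ∀ {F : Baire → Vec ℕ k → Vec ℕ m} → Computable* F →
               Computable (λ g xs → all-defined (F g xs))
all-definedᶜ f = go ∘ᶜ f
  where
  go : ∀ {m} → Computable {m} (λ _ → all-defined)
  go {zero} = computable-≗ (λ { _ [] → refl }) (litᶜ 1)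
  go {suc m} = computable-≗ (λ { _ (x ∷ xs) → refl }) (ifzᶜ headᶜ zeroᶜ (go ∘ᶜ tailᶜ))

map-predᶜ : ∀ {F : Baire → Vec ℕ k → Vec ℕ m} → Computable* F →
            Computable* (λ g xs → map pred (F g xs))
map-predᶜ f = go ∘ᶜ* f
  where
  go : ∀ {m} → Computable* {m} (λ _ → map pred)
  go {zero} = [] computes λ { _ [] → [] }
  go {suc m} = (codes c) computes λ { g (x ∷ xs) → specs c g (x ∷ xs) }
    where
    c : Computable* {suc m} (λ _ xs → pred (head xs) ∷ map pred (tail xs))
    c = predᶜ headᶜ ∷ᶜ (go ∘ᶜ* tailᶜ)

mutual
  -- The code `e` is fixed, so the recursion on it happens outside the computed function; only the
  -- bound, as first argument, and the arguments of `e` are inputs.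
  evalᶜ : (e : Code k) → Computable (λ φ xs → eval φ (head xs) e (tail xs))
  evalᶜ zero = litᶜ 1
  evalᶜ suc = sucᶜ (sucᶜ (headᶜ ∘ᶜ tailᶜ))
  evalᶜ oracle = oracleᶜ (headᶜ ∘ᶜ tailᶜ)
  evalᶜ (proj i) = sucᶜ (var i ∘ᶜ tailᶜ)
  evalᶜ (comp e es) = ifzᶜ (all-definedᶜ (eval*ᶜ es)) zeroᶜ (evalᶜ e ∘ᶜ headᶜ ∷ᶜ map-predᶜ (eval*ᶜ es))
  evalᶜ (prec b e) = natrecᶜ {S = λ φ xs → ifz (head (tail xs)) 0
      (eval φ (head (tail (tail xs))) e (head xs ∷ pred (head (tail xs)) ∷ tail (tail (tail (tail xs)))))}
    (evalᶜ b ∘ᶜ headᶜ ∷ᶜ (tailᶜ ∘ᶜ* tailᶜ))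
    (ifzᶜ (headᶜ ∘ᶜ tailᶜ) zeroᶜ
      (evalᶜ e ∘ᶜ (headᶜ ∘ᶜ tailᶜ ∘ᶜ* tailᶜ) ∷ᶜ headᶜ ∷ᶜ predᶜ (headᶜ ∘ᶜ tailᶜ) ∷ᶜ
        (tailᶜ ∘ᶜ* tailᶜ ∘ᶜ* tailᶜ ∘ᶜ* tailᶜ)))
    (headᶜ ∘ᶜ tailᶜ)
  evalᶜ (mu e) = predᶜ (natrecᶜ {S = λ φ xs → ifz (head (tail xs))
      (mu-step (head xs) (eval φ (head (tail (tail xs))) e (head xs ∷ tail (tail (tail xs)))))
      (head (tail xs))}
    zeroᶜ
    (ifzᶜ (headᶜ ∘ᶜ tailᶜ)
      (mu-stepᶜ headᶜ (evalᶜ e ∘ᶜ (headᶜ ∘ᶜ tailᶜ ∘ᶜ* tailᶜ) ∷ᶜ headᶜ ∷ᶜ (tailᶜ ∘ᶜ* tailᶜ ∘ᶜ* tailᶜ)))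
      (headᶜ ∘ᶜ tailᶜ))
    headᶜ)
    where
    mu-stepᶜ : ∀ {k} {I V : Baire → Vec ℕ k → ℕ} → Computable I → Computable V →
               Computable (λ g xs → mu-step (I g xs) (V g xs))
    mu-stepᶜ i v = ifzᶜ v (litᶜ 1) (ifzᶜ (predᶜ v) (sucᶜ (sucᶜ i)) zeroᶜ)

  eval*ᶜ : (es : Vec (Code k) m) → Computable* (λ φ xs → eval* φ (head xs) es (tail xs))
  eval*ᶜ [] = []ᶜ
  eval*ᶜ (e ∷ es) = evalᶜ e ∷ᶜ eval*ᶜ es

-- Finite restrictions of oracles and the computable tree of a class.

infix 7 _↾_

-- A partial oracle in the encoding of `eval`; `suc x ∸ n` vanishes exactly when `x < n`.
_↾_ : Baire → ℕ → Baire
(f ↾ n) x = ifz (suc x ∸ n) (suc (f x)) 0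

↾-< : ∀ f {n x} → x < n → (f ↾ n) x ≡ suc (f x)
↾-< f x<n rewrite m≤n⇒m∸n≡0 x<n = refl

↾-⊑ : ∀ f n {x y} → (f ↾ n) x ≡ suc y → x < n × f x ≡ y
↾-⊑ f n {x} eq with suc x ∸ n in eq′
↾-⊑ f n {x} refl | zero = m∸n≡0⇒m≤n eq′ , refl

↾-cong : ∀ {n f g} → Agree n f g → f ↾ n ≗ g ↾ n
↾-cong {n} f≈g x with suc x ∸ n in eq
... | zero = cong suc (f≈g (m∸n≡0⇒m≤n eq))
... | suc _ = refl

-- Applied to encoded values, where 1 stands for the result 0: it detects a rejection by `R`.
is-one : ℕ → ℕ
is-one v = ifz v 0 (ifz (pred v) 1 0)

is-one≡0 : ∀ v → v ≢ 1 → is-one v ≡ 0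
is-one≡0 zero _ = refl
is-one≡0 (suc zero) v≢1 = contradiction refl v≢1
is-one≡0 (suc (suc v)) _ = refl

-- conflicts f ℓ ≡ 0 says that the string f 0 … f (ℓ - 1) lies on the
-- computable tree whose paths are the f with f ⊢ R · n ⇓ 1 for all n.
module Tree (R : Code 1) where

  opaque

    conflicts : Baire → ℕ → ℕ
    conflicts f ℓ = ∑< ℓ λ i → is-one (eval (f ↾ ℓ) ℓ R (i ∷ []))

    conflicts-cong : ∀ {ℓ f g} → Agree ℓ f g → conflicts f ℓ ≡ conflicts g ℓ
    conflicts-cong {ℓ} f≈g =
      ∑<-cong ℓ λ {i} _ → cong is-one (eval-cong (↾-cong f≈g) ℓ R (i ∷ []))

    conflicts-zero : ∀ f → conflicts f 0 ≡ 0
    conflicts-zero f = refl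

    conflictsᶜ : Computable {1} (λ f xs → conflicts f (lookup xs zero))
    conflictsᶜ = ∑<ᶜ (var zero) (ifzᶜ e zeroᶜ (ifzᶜ (predᶜ e) (litᶜ 1) zeroᶜ))
      where
      restrict : Computable {3} λ f xs → (f ↾ lookup xs (suc (suc zero))) (lookup xs zero)
      restrict = ifzᶜ (sucᶜ (var zero) ∸ᶜ var (suc (suc zero))) (sucᶜ (oracleᶜ (var zero))) zeroᶜ

      e : Computable {2} λ f xs →
            eval (f ↾ lookup xs (suc zero)) (lookup xs (suc zero)) R (lookup xs zero ∷ [])
      e = with-oracle restrict (evalᶜ R) (var (suc zero) ∷ᶜ var zero ∷ᶜ []ᶜ)

    -- A rejection seen with the restricted oracle would be a true computation with result 0,
    -- against determinism.
    path⇒conflicts≡0 : ∀ {f} → (∀ n → f ⊢ R · n ∷ [] ⇓ 1) → ∀ ℓ → conflicts f ℓ ≡ 0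
    path⇒conflicts≡0 {f} R⇓1 ℓ = ≡0⇒∑<≡0 ℓ λ {i} _ → is-one≡0 _ λ eval≡1 →
      contradiction
        (deterministic (R⇓1 i) (eval-sound (λ eq → proj₂ (↾-⊑ f ℓ eq)) R (i ∷ []) eval≡1)) λ ()

    -- A true rejection is seen at every large enough length. Cofinally many lengths are asked for
    -- because headers and blocks are tested only at the lengths they happen to reach.
    conflicts≡0⇒path : ∀ {f} → (∀ n → f ⊢ R · n ∷ [] ⇓ 0 ⊎ f ⊢ R · n ∷ [] ⇓ 1) →
                       (∀ N → ∃[ ℓ ] N ≤ ℓ × conflicts f ℓ ≡ 0) → ∀ n → f ⊢ R · n ∷ [] ⇓ 1
    conflicts≡0⇒path {f} R⇓ cofinal n with R⇓ n
    ... | inj₂ R⇓1 = R⇓1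
    ... | inj₁ R⇓0 with eval-complete R⇓0
    -- A length above `n` puts input `n` into the sum; a length of at least `N` covers the use and
    -- the search bound.
    ...   | N , ev with cofinal (suc n ⊔ N)
    ...     | ℓ , ≤ℓ , ≡0 = contradiction
      (trans (sym (∑<≡0⇒≡0 ℓ ≡0 (m⊔n≤o⇒m≤o (suc n) N ≤ℓ)))
        (cong is-one (ev N≤ℓ λ x<N → ↾-< f (<-≤-trans x<N N≤ℓ)))) λ ()
      where
      N≤ℓ : N ≤ ℓ
      N≤ℓ = m⊔n≤o⇒n≤o (suc n) N ≤ℓ

-- Sequences as streams of marked and unmarked bits.

double : ℕ → ℕ
double = natrec 0 λ _ r → suc (suc r)

n≤double : ∀ n → n ≤ double n
n≤double zero = z≤n
n≤double (suc n) = s≤s (m≤n⇒m≤1+n (n≤double n))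

double-mono-< : ∀ {m n} → m < n → suc (double m) < double n
double-mono-< {zero} {suc n} _ = s≤s (s≤s z≤n)
double-mono-< {suc m} {suc n} (s≤s m<n) = s≤s (s≤s (double-mono-< m<n))

flag bit : Baire → ℕ → ℕ
flag h j = h (double j)
bit h j = h (suc (double j))

-- Replaces the division in the join by a recursion that removes one entry from each side.
⊕-step : ∀ f g n → (f ⊕ g) (suc (suc n)) ≡ ((f ∘ suc) ⊕ (g ∘ suc)) n
⊕-step f g n rewrite 2+n/2 n = refl

flag-⊕ : ∀ f g j → flag (f ⊕ g) j ≡ f j
flag-⊕ f g zero = refl
flag-⊕ f g (suc j) = trans (⊕-step f g (double j)) (flag-⊕ (f ∘ suc) (g ∘ suc) j)

bit-⊕ : ∀ f g j → bit (f ⊕ g) j ≡ g j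
bit-⊕ f g zero = refl
bit-⊕ f g (suc j) = trans (⊕-step f g (suc (double j))) (bit-⊕ (f ∘ suc) (g ∘ suc) j)

record SymbolsAgree (n : ℕ) (g h : Baire) : Set where
  constructor _,_
  field
    flags : Agree n (flag g) (flag h)
    bits  : Agree n (bit g) (bit h)

open SymbolsAgree

symbols⇒agree : ∀ n {g h} → SymbolsAgree n g h → Agree (double n) g h
symbols⇒agree (suc n) (flags , bits) {zero} _ = flags {0} (s≤s z≤n)
symbols⇒agree (suc n) (flags , bits) {suc zero} _ = bits {0} (s≤s z≤n)
symbols⇒agree (suc n) (flags , bits) {suc (suc x)} (s≤s (s≤s x<)) =
  symbols⇒agree n ((λ j<n → flags (s≤s j<n)) , λ j<n → bits (s≤s j<n)) x<

agree⇒symbols : ∀ {n g h} → Agree (double n) g h → SymbolsAgree n g h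
agree⇒symbols g≈h = (λ j<n → g≈h (<-trans (n<1+n _) (double-mono-< j<n))) , λ j<n → g≈h (double-mono-< j<n)

symbols-≤ : ∀ {m n g h} → m ≤ n → SymbolsAgree n g h → SymbolsAgree m g h
symbols-≤ m≤n (flags , bits) = agree-≤ m≤n flags , agree-≤ m≤n bits

symbols-trans : ∀ {n f g h} → SymbolsAgree n f g → SymbolsAgree n g h → SymbolsAgree n f h
symbols-trans (fs , bs) (fs′ , bs′) = agree-trans fs fs′ , agree-trans bs bs′

-- The join is itself read as a stream of symbols, with `f` as flags and `g` as bits.
⊕-agree : ∀ n {f f′ g} → Agree n f f′ → Agree (double n) (f ⊕ g) (f′ ⊕ g)
⊕-agree n {f} {f′} {g} f≈f′ = symbols⇒agree n
  ( (λ {j} j<n → trans (flag-⊕ f g j) (trans (f≈f′ j<n) (sym (flag-⊕ f′ g j))))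
  , λ {j} _ → trans (bit-⊕ f g j) (sym (bit-⊕ f′ g j)))

⊕-Cantor : ∀ {f g} → f ∈ Cantor → g ∈ Cantor → f ⊕ g ∈ Cantor
⊕-Cantor f<2 g<2 n with n % 2
... | zero = f<2 (n / 2)
... | suc _ = g<2 (n / 2)

-- A sequence h is read as a stream of symbols: symbol j carries the bit
-- h (2j + 1) and is marked when h (2j) ≠ 0.  The marked bits spell the
-- header; the unmarked bits between two marks form a block.

Unmarked : Baire → ℕ → ℕ → Set
Unmarked h m n = ∀ {j} → m ≤ j → j < n → flag h j ≡ 0

block : Baire → ℕ → Baire
block h s x = bit h (s + x)

flagᶜ : Computable F → Computable (λ h xs → flag h (F h xs))
flagᶜ f = oracleᶜ (natrecᶜ zeroᶜ (sucᶜ (sucᶜ (var (suc zero)))) f)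

bitᶜ : Computable F → Computable (λ h xs → bit h (F h xs))
bitᶜ f = oracleᶜ (sucᶜ (natrecᶜ zeroᶜ (sucᶜ (sucᶜ (var (suc zero)))) f))

opaque

  -- On Cantor space flags are 0 or 1, so summing them counts marks.
  marks : Baire → ℕ → ℕ
  marks h = natrec 0 λ i r → r + flag h i

  -- The position just after the last mark before `n`, where the current block begins.
  start : Baire → ℕ → ℕ
  start h = natrec 0 λ i r → ifz (flag h i) r (suc i)

  -- The tested number vanishes exactly when symbol `i` is marked and `marks h i` is `x`. Places not
  -- yet filled get the default 0, which keeps the header in Cantor space.
  header : Baire → ℕ → Baire
  header h n x = natrec 0 (λ i r → ifz ((1 ∸ flag h i) + ∣ marks h i - x ∣) (bit h i) r) n

  marks-zero : ∀ h → marks h 0 ≡ 0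
  marks-zero h = refl

  marks-suc : ∀ h n → marks h (suc n) ≡ marks h n + flag h n
  marks-suc h n = refl

  start-zero : ∀ h → start h 0 ≡ 0
  start-zero h = refl

  start-mark : ∀ h n → flag h n ≡ 1 → start h (suc n) ≡ suc n
  start-mark h n eq rewrite eq = refl

  marks-cong : ∀ g h n → Agree n (flag g) (flag h) → marks g n ≡ marks h n
  marks-cong g h zero _ = refl
  marks-cong g h (suc n) g≈h = cong₂ _+_ (marks-cong g h n (agree-≤ (n≤1+n n) g≈h)) (g≈h ≤-refl)

  start-cong : ∀ g h n → Agree n (flag g) (flag h) → start g n ≡ start h n
  start-cong g h zero _ = refl
  start-cong g h (suc n) g≈h =
    cong₂ (λ b r → ifz b r (suc n)) (g≈h ≤-refl) (start-cong g h n (agree-≤ (n≤1+n n) g≈h))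

  header-cong : ∀ g h n → SymbolsAgree n g h → header g n ≗ header h n
  header-cong g h zero _ x = refl
  header-cong g h (suc n) g≈h@(flags , bits) x = trans
    (cong₂ (λ c r → ifz c (bit g n) r)
      (cong₂ (λ a b → (1 ∸ a) + ∣ b - x ∣) (flags ≤-refl) (marks-cong g h n (agree-≤ (n≤1+n n) flags)))
      (header-cong g h n (symbols-≤ (n≤1+n n) g≈h) x))
    (cong (λ b → ifz ((1 ∸ flag h n) + ∣ marks h n - x ∣) b (header h n x)) (bits ≤-refl))

  marks-mono : ∀ h {m n} → m ≤ n → marks h m ≤ marks h n
  marks-mono h {m} {zero} z≤n = z≤n
  marks-mono h {m} {suc n} m≤1+n with m≤n⇒m<n∨m≡n m≤1+n
  ... | inj₁ (s≤s m≤n) = ≤-trans (marks-mono h m≤n) (m≤m+n _ _)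
  ... | inj₂ refl = ≤-refl

  -- Place `x` is written only at a mark preceded by `x` marks, and from `m` on more marks than that
  -- have passed.
  header-stable : ∀ h {m n x} → m ≤ n → x < marks h m → header h n x ≡ header h m x
  header-stable h {m} {zero} z≤n _ = refl
  header-stable h {m} {suc n} {x} m≤1+n x< with m≤n⇒m<n∨m≡n m≤1+n
  ... | inj₂ refl = refl
  ... | inj₁ (s≤s m≤n) with (1 ∸ flag h n) + ∣ marks h n - x ∣ in eq
  ...   | suc _ = header-stable h m≤n x<
  ...   | zero = contradiction (sym (∣m-n∣≡0⇒m≡n (m+n≡0⇒n≡0 (1 ∸ flag h n) eq)))
                   (<⇒≢ (<-≤-trans x< (marks-mono h m≤n)))

  header-mark : ∀ h n → flag h n ≡ 1 → header h (suc n) (marks h n) ≡ bit h n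
  header-mark h n eq rewrite eq | ∣n-n∣≡0 (marks h n) = refl

  header-Cantor : ∀ {h} → h ∈ Cantor → ∀ n → header h n ∈ Cantor
  header-Cantor h<2 zero x = s≤s z≤n
  header-Cantor {h} h<2 (suc n) x with (1 ∸ flag h n) + ∣ marks h n - x ∣
  ... | zero = h<2 _
  ... | suc _ = header-Cantor h<2 n x

  start≤ : ∀ h n → start h n ≤ n
  start≤ h zero = z≤n
  start≤ h (suc n) with flag h n
  ... | zero = m≤n⇒m≤1+n (start≤ h n)
  ... | suc _ = ≤-refl

  -- Cutting a sequence at the beginning of a block leaves an empty block, so a new block can be
  -- started there.
  start-idem : ∀ h n → start h (start h n) ≡ start h n
  start-idem h zero = refl
  start-idem h (suc n) with flag h n in eq
  ... | zero = start-idem h n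
  ... | suc _ rewrite eq = refl

  start-unmarked : ∀ h {m n} → m ≤ n → Unmarked h m n → start h n ≡ start h m
  start-unmarked h {m} {zero} z≤n _ = refl
  start-unmarked h {m} {suc n} m≤1+n unmarked with m≤n⇒m<n∨m≡n m≤1+n
  ... | inj₂ refl = refl
  ... | inj₁ (s≤s m≤n) rewrite unmarked m≤n ≤-refl =
    start-unmarked h m≤n λ m≤j j<n → unmarked m≤j (m<n⇒m<1+n j<n)

  marks-unmarked : ∀ h {m n} → m ≤ n → Unmarked h m n → marks h n ≡ marks h m
  marks-unmarked h {m} {zero} z≤n _ = refl
  marks-unmarked h {m} {suc n} m≤1+n unmarked with m≤n⇒m<n∨m≡n m≤1+n
  ... | inj₂ refl = refl
  ... | inj₁ (s≤s m≤n) rewrite unmarked m≤n ≤-refl = trans (+-identityʳ _)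
    (marks-unmarked h m≤n λ m≤j j<n → unmarked m≤j (m<n⇒m<1+n j<n))

  marksᶜ : Computable {1} (λ h xs → marks h (lookup xs zero))
  marksᶜ = natrecᶜ zeroᶜ (var (suc zero) +ᶜ flagᶜ (var zero)) (var zero)

  startᶜ : Computable {1} (λ h xs → start h (lookup xs zero))
  startᶜ = natrecᶜ zeroᶜ (ifzᶜ (flagᶜ (var zero)) (var (suc zero)) (sucᶜ (var zero))) (var zero)

  headerᶜ : Computable {2} (λ h xs → header h (lookup xs zero) (lookup xs (suc zero)))
  headerᶜ = natrecᶜ zeroᶜ
    (ifzᶜ ((litᶜ 1 ∸ᶜ flagᶜ (var zero)) +ᶜ distᶜ (marksᶜ ∘ᶜ var zero ∷ᶜ []ᶜ) (var (suc (suc (suc zero)))))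
      (bitᶜ (var zero)) (var (suc zero)))
    (var zero)

blockᶜ : Computable {2} (λ h xs → block h (lookup xs zero) (lookup xs (suc zero)))
blockᶜ = bitᶜ (var zero +ᶜ var (suc zero))

-- Replacing the tail of a stream of symbols.

splice : ℕ → Baire → Baire → Baire
splice zero u v j = v j
splice (suc n) u v zero = u 0
splice (suc n) u v (suc j) = splice n (u ∘ suc) v j

splice-< : ∀ n u v → Agree n (splice n u v) u
splice-< (suc n) u v {zero} _ = refl
splice-< (suc n) u v {suc j} (s≤s j<n) = splice-< n (u ∘ suc) v j<n

splice-+ : ∀ n u v j → splice n u v (n + j) ≡ v j
splice-+ zero u v j = refl
splice-+ (suc n) u v j = splice-+ n (u ∘ suc) v j

splice-Cantor : ∀ n {u v} → u ∈ Cantor → v ∈ Cantor → splice n u v ∈ Cantor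
splice-Cantor zero u<2 v<2 j = v<2 j
splice-Cantor (suc n) u<2 v<2 zero = u<2 0
splice-Cantor (suc n) u<2 v<2 (suc j) = splice-Cantor n (u<2 ∘ suc) v<2 j

splice-symbols : ℕ → Baire → Baire → Baire → Baire
splice-symbols n h a b = splice n (flag h) a ⊕ splice n (bit h) b

module _ (n : ℕ) (h a b : Baire) where

  private
    fs = splice n (flag h) a
    bs = splice n (bit h) b

  splice-agree : SymbolsAgree n (splice-symbols n h a b) h
  splice-agree =
    (λ {j} j<n → trans (flag-⊕ fs bs j) (splice-< n (flag h) a j<n)) ,
    (λ {j} j<n → trans (bit-⊕ fs bs j) (splice-< n (bit h) b j<n))

  flag-splice-+ : ∀ j → flag (splice-symbols n h a b) (n + j) ≡ a j
  flag-splice-+ j = trans (flag-⊕ fs bs (n + j)) (splice-+ n (flag h) a j)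

  bit-splice-+ : ∀ j → bit (splice-symbols n h a b) (n + j) ≡ b j
  bit-splice-+ j = trans (bit-⊕ fs bs (n + j)) (splice-+ n (bit h) b j)

  splice-symbols-Cantor : h ∈ Cantor → a ∈ Cantor → b ∈ Cantor → splice-symbols n h a b ∈ Cantor
  splice-symbols-Cantor h<2 a<2 b<2 =
    ⊕-Cantor (splice-Cantor n (λ j → h<2 (double j)) a<2)
             (splice-Cantor n (λ j → h<2 (suc (double j))) b<2)

-- Binary expansions

shift : ℕ → ℕ → ℕ
shift t = natrec t λ _ r → r / 2

opaque

  digit : ℕ → Baire
  digit t x = shift t x % 2

  digit-Cantor : ∀ t → digit t ∈ Cantor
  digit-Cantor t x = m%n<n (shift t x) 2

  digitᶜ : Computable F → Computable G → Computable (λ g xs → digit (F g xs) (G g xs))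
  digitᶜ f g = %2ᶜ (natrecᶜ f (/2ᶜ (var (suc zero))) g)

  shift-suc : ∀ t x → shift t (suc x) ≡ shift (t / 2) x
  shift-suc t zero = refl
  shift-suc t (suc x) = cong (_/ 2) (shift-suc t x)

  n/2≤pred : ∀ n → n / 2 ≤ pred n
  n/2≤pred zero = z≤n
  n/2≤pred (suc n) = s≤s⁻¹ (m/n<m (suc n) 2 (s≤s (s≤s z≤n)))

  shift≤ : ∀ t x → shift t x ≤ t ∸ x
  shift≤ t zero = ≤-refl
  shift≤ t (suc x) = begin
    shift t x / 2    ≤⟨ n/2≤pred (shift t x) ⟩
    pred (shift t x) ≤⟨ pred-mono-≤ (shift≤ t x) ⟩
    pred (t ∸ x)     ≡⟨ pred[m∸n]≡m∸[1+n] t x ⟩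
    t ∸ suc x        ∎
    where open ≤-Reasoning

  -- Each halving lowers a positive number, so `x` halvings leave at most `t ∸ x`. Placing a digit 1
  -- far out thus forces a code to be large.
  digit≡1⇒< : ∀ t x → digit t x ≡ 1 → x < t
  digit≡1⇒< t x eq with x <? t
  ... | yes x<t = x<t
  ... | no x≮t = contradiction (trans (sym eq) (cong (_% 2) shift≡0)) λ ()
    where
    shift≡0 : shift t x ≡ 0
    shift≡0 = n≤0⇒n≡0 (subst (shift t x ≤_) (m≤n⇒m∸n≡0 (≮⇒≥ x≮t)) (shift≤ t x))

number : Baire → ℕ → ℕ
number h zero = 0
number h (suc n) = h 0 + number (h ∘ suc) n * 2

module _ {a : ℕ} (m : ℕ) (a<2 : a < 2) where

  opaque
    unfolding digit

    digit-zero : digit (a + m * 2) 0 ≡ a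
    digit-zero = trans ([m+kn]%n≡m%n a m 2) (m<n⇒m%n≡m a<2)

    digit-suc : ∀ x → digit (a + m * 2) (suc x) ≡ digit m x
    digit-suc x = cong (_% 2) (trans (shift-suc (a + m * 2) x) (cong (λ t → shift t x) half))
      where
      half : (a + m * 2) / 2 ≡ m
      half = trans (+-distrib-/ a (m * 2) (subst (_< 2) (sym mod) a<2))
                   (cong₂ _+_ (m<n⇒m/n≡0 a<2) (m*n/n≡m m 2))
        where
        mod : a % 2 + m * 2 % 2 ≡ a
        mod = trans (cong₂ _+_ (m<n⇒m%n≡m a<2) (m*n%n≡0 m 2)) (+-identityʳ a)

digit-number-< : ∀ {h} n → h ∈ Cantor → Agree n (digit (number h n)) h
digit-number-< {h} (suc n) h<2 {zero} _ = digit-zero (number (h ∘ suc) n) (h<2 0)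
digit-number-< {h} (suc n) h<2 {suc x} (s≤s x<n) =
  trans (digit-suc (number (h ∘ suc) n) (h<2 0) x) (digit-number-< n (h<2 ∘ suc) x<n)

opaque
  unfolding digit

  digit-number-≥ : ∀ {h} n → h ∈ Cantor → ∀ {x} → n ≤ x → digit (number h n) x ≡ 0
  digit-number-≥ zero h<2 {x} _ = cong (_% 2) (n≤0⇒n≡0 (≤-trans (shift≤ 0 x) (≤-reflexive (0∸n≡0 x))))
  digit-number-≥ {h} (suc n) h<2 {suc x} (s≤s n≤x) =
    trans (digit-suc (number (h ∘ suc) n) (h<2 0) x) (digit-number-≥ n (h<2 ∘ suc) n≤x)

-- The bits after the mark are set so that the number t, which also bounds
-- the running times, can be made large.
number-of-marked : ∀ {h} → h ∈ Cantor → ∀ {b} → b < 2 → ∀ n N →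
  ∃[ t ] N ≤ t × n < t × SymbolsAgree n (digit t) h ×
         flag (digit t) n ≡ 1 × bit (digit t) n ≡ b × (∀ {m} → Unmarked (digit t) (suc n) m)
number-of-marked {h} h<2 {b} b<2 n N =
  t , ≤-trans (m≤n⊔m (suc n) N) (<⇒≤ M<t) , <-trans n<M M<t ,
  symbols-trans (symbols-≤ n≤1+M digit≈g) (splice-agree n h a d) ,
  trans (flags (digit≈g) n<1+M) (at-n (flag g) (flag-splice-+ n h a d 0)) ,
  trans (bits (digit≈g) n<1+M) (at-n (bit g) (bit-splice-+ n h a d 0)) ,
  λ {_} {j} n<j _ → unmarked n<j
  where
  a d : Baire
  a zero = 1
  a (suc _) = 0
  d zero = b
  d (suc _) = 1

  M = suc n ⊔ N
  n<M = m≤m⊔n (suc n) N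
  n<1+M = m<n⇒m<1+n n<M
  n≤1+M = <⇒≤ n<1+M
  g = splice-symbols n h a d
  t = number g (double (suc M))

  g<2 : g ∈ Cantor
  g<2 = splice-symbols-Cantor n h a d h<2
    (λ { zero → s≤s (s≤s z≤n) ; (suc _) → s≤s z≤n }) (λ { zero → b<2 ; (suc _) → s≤s (s≤s z≤n) })

  digit≈g : SymbolsAgree (suc M) (digit t) g
  digit≈g = agree⇒symbols (digit-number-< (double (suc M)) g<2)

  at-n : ∀ (u : Baire) {x} → u (n + 0) ≡ x → u n ≡ x
  at-n u eq = subst (λ m → u m ≡ _) (+-identityʳ n) eq

  after-n : ∀ {P : ℕ → Set} → (∀ i → P (n + suc i)) → ∀ {j} → n < j → P j
  after-n {P} p {j} n<j = subst P (trans (+-suc n _) (m+[n∸m]≡n n<j)) (p (j ∸ suc n))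

  M<t : M < t
  M<t = ≤-<-trans (≤-trans (n≤double M) (n≤1+n _)) (digit≡1⇒< t (suc (double M))
    (trans (bits digit≈g ≤-refl)
           (after-n {λ j → bit g j ≡ 1} (λ i → bit-splice-+ n h a d (suc i)) n<M)))

  unmarked : ∀ {j} → n < j → flag (digit t) j ≡ 0
  unmarked {j} n<j with j <? suc M
  ... | yes j<1+M = trans (flags digit≈g j<1+M)
    (after-n {λ j → flag g j ≡ 0} (λ i → flag-splice-+ n h a d (suc i)) n<j)
  ... | no j≮1+M = digit-number-≥ (double (suc M)) g<2 (double-mono-≤ (≮⇒≥ j≮1+M))
    where
    double-mono-≤ : ∀ {m n} → m ≤ n → double m ≤ double n
    double-mono-≤ z≤n = z≤n
    double-mono-≤ (s≤s m≤n) = s≤s (s≤s (double-mono-≤ m≤n))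

-- The class `ℬ` of sequences with header and blocks on the tree.

module Blocks (R : Code 1) where

  open Tree R public

  opaque

    -- Only the block in progress at `n` is tested; completed blocks were tested at smaller `n`.
    defect : Baire → ℕ → ℕ
    defect h n = conflicts (header h n) (marks h n) + conflicts (block h (start h n)) (n ∸ start h n)

    defect-cong : ∀ g h n → SymbolsAgree n g h → defect g n ≡ defect h n
    defect-cong g h n g≈h@(flags , bits)
      rewrite sym (marks-cong g h n flags) | sym (start-cong g h n flags) =
      cong₂ _+_ (conflicts-cong {marks g n} λ _ → header-cong g h n g≈h _)
        (conflicts-cong {n ∸ start g n} λ x< → bits
          (<-≤-trans (+-monoʳ-< (start g n) x<) (≤-reflexive (m+[n∸m]≡n (start≤ g n)))))

    defectᶜ : Computable {1} (λ h xs → defect h (lookup xs zero))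
    defectᶜ = with-oracle (headerᶜ ∘ᶜ var (suc zero) ∷ᶜ var zero ∷ᶜ []ᶜ) conflictsᶜ (marksᶜ ∷ᶜ []ᶜ)
      +ᶜ with-oracle (blockᶜ ∘ᶜ (startᶜ ∘ᶜ var (suc zero) ∷ᶜ []ᶜ) ∷ᶜ var zero ∷ᶜ []ᶜ) conflictsᶜ
           ((var zero ∸ᶜ startᶜ) ∷ᶜ []ᶜ)

    defect-zero : ∀ h → defect h 0 ≡ 0
    defect-zero h rewrite marks-zero h | 0∸n≡0 (start h 0) = cong₂ _+_ (conflicts-zero _) (conflicts-zero _)

    header-ok : ∀ {h n} → defect h n ≡ 0 → conflicts (header h n) (marks h n) ≡ 0
    header-ok eq = m+n≡0⇒m≡0 _ eq

    block-ok : ∀ {h n} → defect h n ≡ 0 → conflicts (block h (start h n)) (n ∸ start h n) ≡ 0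
    block-ok {h} {n} eq = m+n≡0⇒n≡0 (conflicts (header h n) (marks h n)) eq

    defect-ok : ∀ {h n} → conflicts (header h n) (marks h n) ≡ 0 →
                conflicts (block h (start h n)) (n ∸ start h n) ≡ 0 → defect h n ≡ 0
    defect-ok = cong₂ _+_

  ℬ : Subset
  ℬ h = h ∈ Cantor × (∀ n → defect h n ≡ 0)

  module _ {s h f} (h<2 : h ∈ Cantor) (f<2 : f ∈ Cantor) (path : ∀ ℓ → conflicts f ℓ ≡ 0)
           (s-starts : start h s ≡ s) (h-ok : ∀ {n} → n ≤ s → defect h n ≡ 0) where

    private
      g = splice-symbols s h (λ _ → 0) f
      g≈h = splice-agree s h (λ _ → 0) f

    -- No marks follow position `s`, so the header stays as it was, and since a block begins at `s`
    -- the last block is a part of `f` alone.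
    append-path : g ∈ ℬ
    append-path = splice-symbols-Cantor s h _ f h<2 (λ _ → s≤s z≤n) f<2 , ok
      where
      unmarked : ∀ {n} → Unmarked g s n
      unmarked s≤j _ = subst (λ j → flag g j ≡ 0) (m+[n∸m]≡n s≤j) (flag-splice-+ s h _ f _)

      ok : ∀ n → defect g n ≡ 0
      ok n with ≤-total n s
      ... | inj₁ n≤s = trans (defect-cong g h n (symbols-≤ n≤s g≈h)) (h-ok n≤s)
      ... | inj₂ s≤n
        = defect-ok
        (subst (λ ℓ → conflicts (header g n) ℓ ≡ 0) (sym (marks-unmarked g s≤n unmarked))
          (trans (conflicts-cong {marks g s} (λ x< → header-stable g s≤n x<))
                 (header-ok (trans (defect-cong g h s g≈h) (h-ok ≤-refl)))))
        (subst (λ s → conflicts (block g s) (n ∸ s) ≡ 0) (sym start≡s)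
          (trans (conflicts-cong {n ∸ s} {g = f} (λ {x} _ → bit-splice-+ s h _ f x)) (path (n ∸ s))))
        where
        start≡s : start g n ≡ s
        start≡s = trans (start-unmarked g s≤n unmarked) (trans (start-cong g h s (flags g≈h)) s-starts)

header-unique : ∀ h {m n x} → x < marks h m → x < marks h n → header h m x ≡ header h n x
header-unique h {m} {n} x<m x<n with ≤-total m n
... | inj₁ m≤n = sym (header-stable h m≤n x<m)
... | inj₂ n≤m = header-stable h n≤m x<n

-- Finite strings enter computations as numbers that are decoded into oracles.
with-digits : ∀ {T : Baire → Vec ℕ k → ℕ} {F : Baire → Vec ℕ m → ℕ} {V : Baire → Vec ℕ k → Vec ℕ m} →
              Computable T → Computable F → Computable* V →
              Computable (λ g xs → F (digit (T g xs)) (V g xs))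
with-digits t f v = with-oracle (digitᶜ (t ∘ᶜ tailᶜ) headᶜ) f v

⊕ᶜ : ∀ {T X : Baire → Vec ℕ k → ℕ} → Computable T → Computable X →
     Computable (λ g xs → (digit (T g xs) ⊕ g) (X g xs))
⊕ᶜ {T = T} {X} t x = computable-≗ (λ g xs → eq (digit (T g xs)) g (X g xs))
  (ifzᶜ (%2ᶜ x) (digitᶜ t (/2ᶜ x)) (oracleᶜ (/2ᶜ x)))
  where
  eq : ∀ f g n → ifz (n % 2) (f (n / 2)) (g (n / 2)) ≡ (f ⊕ g) n
  eq f g n with n % 2
  ... | zero = refl
  ... | suc _ = refl

-- `ℬ` is a nonempty effectively closed class, and nonzero if `P` is.

module Anticupping {P : Subset} (P-satisfiable : Satisfiable P) (R : Code 1)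
  (R⇓ : ∀ f → f ∈ Cantor → ∀ n → f ⊢ R · n ∷ [] ⇓ 0 ⊎ f ⊢ R · n ∷ [] ⇓ 1)
  (P⇔ : ∀ f → f ∈ P ⇔ (f ∈ Cantor × (∀ n → f ⊢ R · n ∷ [] ⇓ 1))) where

  open Blocks R

  P⇒Cantor : ∀ {f} → f ∈ P → f ∈ Cantor
  P⇒Cantor f∈P = proj₁ (Equivalence.to (P⇔ _) f∈P)

  P⇒conflicts≡0 : ∀ {f} → f ∈ P → ∀ ℓ → conflicts f ℓ ≡ 0
  P⇒conflicts≡0 f∈P = path⇒conflicts≡0 (proj₂ (Equivalence.to (P⇔ _) f∈P))

  conflicts≡0⇒P : ∀ {f} → f ∈ Cantor → (∀ N → ∃[ ℓ ] N ≤ ℓ × conflicts f ℓ ≡ 0) → f ∈ P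
  conflicts≡0⇒P f<2 cofinal =
    Equivalence.from (P⇔ _) (f<2 , conflicts≡0⇒path (R⇓ _ f<2) cofinal)

  -- A member of `P` written as one unmarked block.
  ℬ-satisfiable : Satisfiable ℬ
  ℬ-satisfiable = _ , append-path {s = 0} {h = λ _ → 0} (λ _ → s≤s z≤n) (P⇒Cantor f∈P)
    (P⇒conflicts≡0 f∈P) (start-zero _) λ { z≤n → defect-zero _ }
    where f∈P = proj₂ P-satisfiable

  ℬ-Π⁰₁ : Π⁰₁ ℬ
  ℬ-Π⁰₁ = code c , (λ f _ n → two-valued (defect f n) (spec c f (n ∷ []))) , λ f → mk⇔
    (λ (f<2 , ok) → f<2 , λ n → subst (λ d → f ⊢ code c · n ∷ [] ⇓ 1 ∸ d) (ok n) (spec c f (n ∷ [])))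
    (λ (f<2 , c⇓1) → f<2 , λ n → ∸≡1 (defect f n) (deterministic (spec c f (n ∷ [])) (c⇓1 n)))
    where
    c : Computable {1} λ f xs → 1 ∸ defect f (lookup xs zero)
    c = litᶜ 1 ∸ᶜ defectᶜ

    two-valued : ∀ d {f xs} → f ⊢ code c · xs ⇓ 1 ∸ d → f ⊢ code c · xs ⇓ 0 ⊎ f ⊢ code c · xs ⇓ 1
    two-valued zero = inj₂
    two-valued (suc d) {f} {xs} ⇓ = inj₁ (subst (f ⊢ code c · xs ⇓_) (0∸n≡0 d) ⇓)

    ∸≡1 : ∀ d → 1 ∸ d ≡ 1 → d ≡ 0
    ∸≡1 zero _ = refl
    ∸≡1 (suc zero) ()
    ∸≡1 (suc (suc d)) ()

  module _ (em : ExcludedMiddle 0ℓ) where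

    -- Whether the marks end is decided classically, so `Γ` depends on `h`. This is enough for a
    -- single computable `h`.
    compute-path : ∀ {h} → h ∈ ℬ → ∃[ Γ ] ∃[ f ] f ∈ P × Γ ⟨ h ⟩= f
    compute-path {h} (h<2 , ok) with em {∃[ m ] (∀ {n} → Unmarked h m n)}
    ... | yes (m , unmarked) = code c , block h s ,
      -- Position `m + N` lies beyond the last mark, and `s ≤ m` leaves at least `N` bits in the
      -- block.
      conflicts≡0⇒P (λ x → h<2 _) (λ N → m + N ∸ s ,
        ≤-trans (≤-reflexive (sym (m+n∸m≡n m N))) (∸-monoʳ-≤ (m + N) (start≤ h m)) ,
        subst (λ s → conflicts (block h s) (m + N ∸ s) ≡ 0) (start-unmarked h (m≤m+n m N) unmarked)
          (block-ok (ok (m + N)))) ,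
      λ n → spec c h (n ∷ [])
      where
      s = start h m
      c : Computable {1} λ h xs → block h s (lookup xs zero)
      c = blockᶜ ∘ᶜ litᶜ s ∷ᶜ var zero ∷ᶜ []ᶜ
    -- Bit `x` of the header is read at the first position with more than `x` marks before it.
    ... | no ¬unmarked = comp (code headerᶜ) (mu (code c) ∷ proj zero ∷ []) , f ,
      conflicts≡0⇒P (λ x → header-Cantor h<2 (stage x) x) (λ N →
        let n , N≤marks = unbounded N in
        marks h n , N≤marks ,
        trans (conflicts-cong {marks h n} (header-unique h (stage-late _))) (header-ok (ok n))) ,
      λ n → comp (proj₂ (proj₂ (search n)) ∷ proj zero ∷ []) (spec headerᶜ h _)
      where
      next-mark : ∀ m → ∃[ n ] m ≤ n × flag h n ≢ 0
      next-mark m with em {∃[ n ] m ≤ n × flag h n ≢ 0}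
      ... | yes found = found
      ... | no ¬found = contradiction (m , λ {_} {j} m≤j _ → unmarked m≤j) ¬unmarked
        where
        unmarked : ∀ {j} → m ≤ j → flag h j ≡ 0
        unmarked {j} m≤j with flag h j ≟ 0
        ... | yes eq = eq
        ... | no ≢0 = contradiction (j , m≤j , ≢0) ¬found

      unbounded : ∀ k → ∃[ n ] k ≤ marks h n
      unbounded zero = 0 , z≤n
      unbounded (suc k) with unbounded k
      ... | m , k≤ with next-mark m
      ...   | n , m≤n , ≢0 = suc n , subst₂ _≤_ (+-comm k 1) (sym (marks-suc h n))
        (+-mono-≤ (≤-trans k≤ (marks-mono h m≤n)) (n≢0⇒n>0 ≢0))

      c : Computable {2} λ h xs → suc (lookup xs (suc zero)) ∸ marks h (lookup xs zero)
      c = sucᶜ (var (suc zero)) ∸ᶜ (marksᶜ ∘ᶜ var zero ∷ᶜ []ᶜ)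

      search : ∀ x → ∃[ n ] suc x ∸ marks h n ≡ 0 × h ⊢ mu (code c) · x ∷ [] ⇓ n
      search x = mu⇓ c h (x ∷ []) (m≤n⇒m∸n≡0 (proj₂ (unbounded (suc x))))

      stage : ℕ → ℕ
      stage x = proj₁ (search x)

      stage-late : ∀ x → x < marks h (stage x)
      stage-late x = m∸n≡0⇒m≤n (proj₁ (proj₂ (search x)))

      f : Baire
      f x = header h (stage x) x

    -- Feeding the zero sequence to `Γ` gives a computable member of `ℬ` and hence one of `P`.
    -- Replacing the oracle by the code of the zero sequence makes this work from every oracle.
    ℬ≤𝟎⇒P≤𝟎 : ℬ ≤¹₁ 𝟎 → P ≤¹₁ 𝟎
    ℬ≤𝟎⇒P≤𝟎 (Γ , Γ-total) =
      let h , h∈ℬ , Γ0=h = Γ-total (λ _ → 0) _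
          Δ , f , f∈P , Δh=f = compute-path h∈ℬ
      in relativise (code (zeroᶜ {1})) (relativise Γ Δ) , λ g _ → f , f∈P , λ n →
           relativise⇓ (λ x → spec zeroᶜ g (x ∷ [])) (relativise⇓ Γ0=h (Δh=f n))

  -- The stagewise construction of a header that follows the output of `Γ`.

  -- The string coded by `t` ends with the last mark among the first `t` symbols of its binary
  -- expansion, so no length has to be stored.
  length : ℕ → ℕ
  length t = start (digit t) t

  module _ (Γ : Code 1) where

    -- The finite part of digit t ⊕ c that t determines.
    window : Baire → ℕ → Baire
    window c t = (digit t ⊕ c) ↾ double (double (length t))

    extends : ℕ → ℕ → ℕ
    extends t′ t = ∑< (double (length t)) λ x → ∣ digit t′ x - digit t x ∣

    defects : ℕ → ℕ
    defects t = ∑< (suc (length t)) λ n → defect (digit t) n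

    -- The code `t` doubles as the search bound of the evaluation, which makes the condition
    -- decidable from `c`.
    wrong-outputs : Baire → ℕ → ℕ → ℕ
    wrong-outputs c k t =
      ∑< k λ i → ∣ eval (window c t) t Γ (i ∷ []) - suc (header (digit t) (length t) i) ∣

    lengthᶜ : ∀ {T : Baire → Vec ℕ k → ℕ} → Computable T → Computable (λ g xs → length (T g xs))
    lengthᶜ t = with-digits t startᶜ (t ∷ᶜ []ᶜ)

    doubleᶜ : ∀ {T : Baire → Vec ℕ k → ℕ} → Computable T → Computable (λ g xs → double (T g xs))
    doubleᶜ t = natrecᶜ zeroᶜ (sucᶜ (sucᶜ (var (suc zero)))) t

    -- t codes a string of symbols with k marks whose header is the beginning
    -- of the output of Γ.
    record Stage (c : Baire) (k t : ℕ) : Set where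
      constructor stage
      field
        ok      : defects t ≡ 0
        count   : marks (digit t) (length t) ≡ k
        outputs : wrong-outputs c k t ≡ 0

    open Stage

    opaque

      test : Baire → ℕ → ℕ → ℕ → ℕ
      test c t′ k t = extends t′ t + (defects t′ +
        (∣ marks (digit t′) (length t′) - suc k ∣ + wrong-outputs c (suc k) t′))

      testᶜ : Computable {3} λ c xs →
                test c (lookup xs zero) (lookup xs (suc zero)) (lookup xs (suc (suc zero)))
      testᶜ = ∑<ᶜ (doubleᶜ (lengthᶜ (var (suc (suc zero)))))
                  (distᶜ (digitᶜ (var (suc zero)) (var zero)) (digitᶜ (var (suc (suc (suc zero)))) (var zero)))
        +ᶜ (∑<ᶜ (sucᶜ (lengthᶜ (var zero))) (with-digits (var (suc zero)) defectᶜ (var zero ∷ᶜ []ᶜ))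
        +ᶜ (distᶜ (with-digits (var zero) marksᶜ (lengthᶜ (var zero) ∷ᶜ []ᶜ)) (sucᶜ (var (suc zero)))
        +ᶜ ∑<ᶜ (sucᶜ (var (suc zero)))
               (distᶜ (with-oracle windowᶜ (evalᶜ Γ) (var (suc zero) ∷ᶜ var zero ∷ᶜ []ᶜ))
                      (sucᶜ (with-digits (var (suc zero)) headerᶜ (lengthᶜ (var (suc zero)) ∷ᶜ var zero ∷ᶜ []ᶜ))))))
        where
        windowᶜ : Computable {5} λ c xs → window c (lookup xs (suc (suc zero))) (lookup xs zero)
        windowᶜ = ifzᶜ (sucᶜ (var zero) ∸ᶜ doubleᶜ (doubleᶜ (lengthᶜ (var (suc (suc zero))))))
          (sucᶜ (⊕ᶜ (var (suc (suc zero))) (var zero))) zeroᶜ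

      test≡0⇒ : ∀ {c t′ k t} → test c t′ k t ≡ 0 →
                Agree (double (length t)) (digit t′) (digit t) × Stage c (suc k) t′
      test≡0⇒ {t′ = t′} {k} {t} eq =
        let eq₁ = m+n≡0⇒n≡0 (extends t′ t) eq
            eq₂ = m+n≡0⇒n≡0 (defects t′) eq₁
        in (λ x< → ∣m-n∣≡0⇒m≡n (∑<≡0⇒≡0 (double (length t)) (m+n≡0⇒m≡0 _ eq) x<)) ,
           stage (m+n≡0⇒m≡0 _ eq₁) (∣m-n∣≡0⇒m≡n (m+n≡0⇒m≡0 _ eq₂)) (m+n≡0⇒n≡0 ∣ marks (digit t′) (length t′) - suc k ∣ eq₂)

      ⇒test≡0 : ∀ {c t′ k t} → Agree (double (length t)) (digit t′) (digit t) → Stage c (suc k) t′ →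
                test c t′ k t ≡ 0
      ⇒test≡0 {t = t} t′≈t (stage ok count outputs) = cong₂ _+_
        (≡0⇒∑<≡0 (double (length t)) λ x< → m≡n⇒∣m-n∣≡0 (t′≈t x<))
        (cong₂ _+_ ok (cong₂ _+_ (m≡n⇒∣m-n∣≡0 count) outputs))

    module _ {C : Subset} (Γ-total : ∀ g → g ∈ ℬ ⊗ C → ∃[ f ] f ∈ P × Γ ⟨ g ⟩= f) {c} (c∈C : c ∈ C) where

      stage-zero : Stage c 0 0
      stage-zero = stage
        (≡0⇒∑<≡0 (suc (length 0)) λ {n} n<1+0 → subst (λ n → defect (digit 0) n ≡ 0)
          (sym (n<1⇒n≡0 (subst (λ l → n < suc l) (start-zero _) n<1+0))) (defect-zero (digit 0)))
        (trans (cong (marks (digit 0)) (start-zero _)) (marks-zero _))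
        refl

      -- The coded string followed by a member of `P` is some `g` in `ℬ`, so `Γ` has an output `q`
      -- in `P` on `g ⊕ c`. Cutting `g` beyond the use of the first `suc k` values and appending
      -- `q k` as a mark gives the required string: its header is an initial segment of `q`.
      next-stage : ∀ {k t} → Stage c k t → ∃[ t′ ] test c t′ k t ≡ 0
      next-stage {k} {t} (stage ok count outputs) = t′ , ⇒test≡0 {k = k} {t}
          (symbols⇒agree s (symbols-trans (symbols-≤ s≤n t′≈g) g≈h))
          (stage (subst (λ l → ∑< (suc l) (defect h′) ≡ 0) (sym length≡) (≡0⇒∑<≡0 (suc (suc n)) defect≡0))
          (trans (cong (marks h′) length≡) marks≡)
          (≡0⇒∑<≡0 (suc k) λ i<1+k → m≡n⇒∣m-n∣≡0 (eval≡ i<1+k)))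
        where
        h = digit t
        s = length t
        f = proj₁ P-satisfiable
        f∈P = proj₂ P-satisfiable
        g = splice-symbols s h (λ _ → 0) f
        g≈h = splice-agree s h (λ _ → 0) f

        g∈ℬ : g ∈ ℬ
        g∈ℬ = append-path (digit-Cantor t) (P⇒Cantor f∈P) (P⇒conflicts≡0 f∈P) (start-idem h t)
          λ n≤s → ∑<≡0⇒≡0 (suc s) ok (s≤s n≤s)

        Γg = Γ-total (g ⊕ c) (g , c , g∈ℬ , c∈C , λ _ → refl)
        q = proj₁ Γg
        q∈P = proj₁ (proj₂ Γg)
        Γg=q = proj₂ (proj₂ Γg)

        bound : ∃[ N ] (∀ {i} → i < suc k → EvaluatesFrom (g ⊕ c) Γ (i ∷ []) (q i) N)
        bound = bounded-sup (suc k) (λ {i} → evaluates-≤ {e = Γ}) λ {i} _ → eval-complete (Γg=q i)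

        N = proj₁ bound
        -- The cut keeps the old string, of length `s`, and covers the use `N`.
        n = s ⊔ N
        s≤n = m≤m⊔n s N
        N≤n = m≤n⊔m s N

        -- The mark carries the next output; a code of at least `N` leaves the searches enough room.
        marked = number-of-marked (proj₁ g∈ℬ) (P⇒Cantor q∈P k) n N
        t′ = proj₁ marked
        h′ = digit t′

        N≤t′ : N ≤ t′
        N≤t′ = proj₁ (proj₂ marked)

        t′≈g : SymbolsAgree n h′ g
        t′≈g = proj₁ (proj₂ (proj₂ (proj₂ marked)))

        flag-n : flag h′ n ≡ 1
        flag-n = proj₁ (proj₂ (proj₂ (proj₂ (proj₂ marked))))

        bit-n : bit h′ n ≡ q k
        bit-n = proj₁ (proj₂ (proj₂ (proj₂ (proj₂ (proj₂ marked)))))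

        length≡ : length t′ ≡ suc n
        length≡ = trans
          (start-unmarked h′ (proj₁ (proj₂ (proj₂ marked))) (proj₂ (proj₂ (proj₂ (proj₂ (proj₂ (proj₂ marked)))))))
          (start-mark h′ n flag-n)

        g-unmarked : ∀ {m} → Unmarked g s m
        g-unmarked s≤j _ = subst (λ j → flag g j ≡ 0) (m+[n∸m]≡n s≤j) (flag-splice-+ s h _ f _)

        marks-g : marks g s ≡ k
        marks-g = trans (marks-cong g h s (flags g≈h)) count

        marks-n : marks h′ n ≡ k
        marks-n = trans (marks-cong h′ g n (flags t′≈g)) (trans (marks-unmarked g s≤n g-unmarked) marks-g)

        marks≡ : marks h′ (suc n) ≡ suc k
        marks≡ = trans (marks-suc h′ n) (trans (cong₂ _+_ marks-n flag-n) (+-comm k 1))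

        -- The old evaluations used only a window on which `h ⊕ c` and `g ⊕ c` agree, so they are
        -- also correct for `g ⊕ c`.
        old-output : ∀ {i} → i < k → header h s i ≡ q i
        old-output {i} i<k = deterministic
          (eval-sound (λ {x} eq → let x< , h≡ = ↾-⊑ (h ⊕ c) (double (double s)) eq in
              trans (⊕-agree (double s) {g = c} (symbols⇒agree s g≈h) x<) h≡)
            Γ (i ∷ []) (∣m-n∣≡0⇒m≡n (∑<≡0⇒≡0 k outputs i<k)))
          (Γg=q i)

        header≡ : Agree (suc k) (header h′ (suc n)) q
        header≡ {i} i<1+k with m<1+n⇒m<n∨m≡n i<1+k
        ... | inj₁ i<k = begin
          header h′ (suc n) i ≡⟨ header-stable h′ (n≤1+n n) (subst (i <_) (sym marks-n) i<k) ⟩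
          header h′ n i       ≡⟨ header-cong h′ g n t′≈g i ⟩
          header g n i        ≡⟨ header-stable g s≤n (subst (i <_) (sym marks-g) i<k) ⟩
          header g s i        ≡⟨ header-cong g h s g≈h i ⟩
          header h s i        ≡⟨ old-output i<k ⟩
          q i                 ∎
          where open ≡-Reasoning
        ... | inj₂ refl = trans (cong (header h′ (suc n)) (sym marks-n)) (trans (header-mark h′ n flag-n) bit-n)

        defect≡0 : ∀ {m} → m < suc (suc n) → defect h′ m ≡ 0
        defect≡0 {m} m<2+n with m<1+n⇒m<n∨m≡n m<2+n
        ... | inj₁ (s≤s m≤n) = trans (defect-cong h′ g m (symbols-≤ m≤n t′≈g)) (proj₂ g∈ℬ m)
        -- Just after the new mark the header is an initial segment of `q` and the block is empty.
        ... | inj₂ refl = defect-ok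
          (subst (λ ℓ → conflicts (header h′ (suc n)) ℓ ≡ 0) (sym marks≡)
            (trans (conflicts-cong header≡) (P⇒conflicts≡0 q∈P (suc k))))
          (subst (λ ℓ → conflicts (block h′ (start h′ (suc n))) ℓ ≡ 0)
            (sym (trans (cong (suc n ∸_) (start-mark h′ n flag-n)) (n∸n≡0 (suc n)))) (conflicts-zero _))

        eval≡ : ∀ {i} → i < suc k → eval (window c t′) t′ Γ (i ∷ []) ≡ suc (header h′ (length t′) i)
        eval≡ {i} i<1+k = trans
          -- Below `N` the new window is defined and agrees with `g ⊕ c`.
          (proj₂ bound i<1+k N≤t′ λ {x} x<N → trans
            (↾-< (h′ ⊕ c) (<-≤-trans x<N (subst (λ l → N ≤ double (double l)) (sym length≡)
              (≤-trans N≤n (≤-trans (n≤1+n n) (≤-trans (n≤double (suc n)) (n≤double (double (suc n)))))))))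
            (cong suc (⊕-agree (double n) {g = c} (symbols⇒agree n t′≈g)
              (<-≤-trans x<N (≤-trans N≤n (≤-trans (n≤double n) (n≤double (double n))))))))
          (cong suc (sym (trans (cong (λ l → header h′ l i) length≡) (header≡ i<1+k))))

      opaque

        step : ∀ {k t} → Stage c k t → ∃[ t′ ] c ⊢ mu (code testᶜ) · k ∷ t ∷ [] ⇓ t′ ×
               Agree (double (length t)) (digit t′) (digit t) × Stage c (suc k) t′
        step {k} {t} t-stage =
          let t′ , test≡0 , t′⇓ = mu⇓ testᶜ c (k ∷ t ∷ []) (proj₂ (next-stage t-stage))
          in t′ , t′⇓ , test≡0⇒ test≡0

      -- The searches are iterated by primitive recursion from 0, the code of the empty string, so
      -- `c` computes the sequence of codes.
      stages : ∀ k → ∃[ t ] c ⊢ prec zero (mu (code testᶜ)) · k ∷ [] ⇓ t × Stage c k t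
      stages zero = 0 , prec-zero zero , stage-zero
      stages (suc k) =
        let t , t⇓ , t-stage = stages k
            t′ , t′⇓ , _ , t′-stage = step t-stage
        in t′ , prec-suc t⇓ t′⇓ , t′-stage

      output : ℕ → Baire
      output k = header (digit t) (length t) where t = proj₁ (stages k)

      output-stable : ∀ {k i} → i < k → output (suc k) i ≡ output k i
      output-stable {k} {i} i<k = trans
        (header-unique (digit t′)
          (subst (i <_) (sym (count t′-stage)) (m<n⇒m<1+n i<k))
          (subst (i <_) (sym (trans (marks-cong (digit t′) (digit t) (length t) (flags t′≈t)) (count t-stage))) i<k))
        (header-cong (digit t′) (digit t) (length t) t′≈t i)
        where
        t t′ : ℕ
        t = proj₁ (stages k)
        t′ = proj₁ (stages (suc k))

        t-stage : Stage c k t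
        t-stage = proj₂ (proj₂ (stages k))

        t′-stage : Stage c (suc k) t′
        t′-stage = proj₂ (proj₂ (stages (suc k)))

        t′≈t : SymbolsAgree (length t) (digit t′) (digit t)
        t′≈t = agree⇒symbols (proj₁ (proj₂ (proj₂ (step t-stage))))

      limit : Baire
      -- Stage `suc i` is the first whose header reaches place `i`.
      limit i = output (suc i) i

      limit≈output : ∀ k → Agree k limit (output k)
      limit≈output (suc k) i<1+k with m<1+n⇒m<n∨m≡n i<1+k
      ... | inj₁ i<k = trans (limit≈output k i<k) (sym (output-stable i<k))
      ... | inj₂ refl = refl

      -- The header at stage `k` has length exactly `k`, lies on the tree, and is an initial segment
      -- of the limit.
      limit∈P : limit ∈ P
      limit∈P = conflicts≡0⇒P (λ i → header-Cantor (digit-Cantor (proj₁ (stages (suc i)))) (length _) i)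
        λ k → k , ≤-refl , conflicts-limit k
        where
        conflicts-limit : ∀ k → conflicts limit k ≡ 0
        conflicts-limit k = trans (conflicts-cong (limit≈output k))
          (subst (λ k′ → conflicts (output k) k′ ≡ 0) (count t-stage)
            (header-ok (∑<≡0⇒≡0 (suc (length t)) (ok t-stage) ≤-refl)))
          where
          t = proj₁ (stages k)
          t-stage = proj₂ (proj₂ (stages k))

    outputᶜ : Computable {2} λ _ xs →
                header (digit (lookup xs zero)) (length (lookup xs zero)) (lookup xs (suc zero))
    outputᶜ = with-digits (var zero) headerᶜ (lengthᶜ (var zero) ∷ᶜ var (suc zero) ∷ᶜ []ᶜ)

  -- The members of `P` used at each stage only prove that the searches halt; the code refers to `Γ`
  -- and `R` alone, so one functional serves all `c` in `C`.
  P≤ℬ⊗C⇒P≤C : ∀ {C} → P ≤¹₁ ℬ ⊗ C → P ≤¹₁ C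
  P≤ℬ⊗C⇒P≤C {C} (Γ , Γ-total) =
    comp (code (outputᶜ Γ)) (comp (prec zero (mu (code (testᶜ Γ)))) (comp suc (proj zero ∷ []) ∷ []) ∷ proj zero ∷ []) ,
    λ c c∈C → limit Γ Γ-total c∈C , limit∈P Γ Γ-total c∈C , λ n →
      comp (comp (comp (proj zero ∷ []) suc ∷ []) (proj₁ (proj₂ (stages Γ Γ-total c∈C (suc n)))) ∷ proj zero ∷ [])
           (spec (outputᶜ Γ) c _)

-- Transfer from the representative `P` to the degree of `A`.

corollary33 : ExcludedMiddle 0ℓ → ∀ (A : Subset) → A ∈ 𝒫¹₁ → Nonzero A → StrongAnticupping A
corollary33 em A (P , P-satisfiable , (R , R⇓ , P⇔) , A≤P , P≤A) A≢𝟎 =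
  ℬ , (ℬ , ℬ-satisfiable , ℬ-Π⁰₁ , ≤¹₁-refl , ≤¹₁-refl) ,
  (λ (ℬ≤𝟎 , _) → A≢𝟎 (≤¹₁-trans A≤P (ℬ≤𝟎⇒P≤𝟎 em ℬ≤𝟎) , 𝟎-minimum A)) ,
  λ C A≤ℬ⊗C → ≤¹₁-trans A≤P (P≤ℬ⊗C⇒P≤C (≤¹₁-trans P≤A A≤ℬ⊗C))
  where
  open Blocks R using (ℬ)
  open Anticupping P-satisfiable R R⇓ P⇔
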